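{- Let $G\neq K_4$ be a $4$-Ore graph with exactly four triangles. Let $x,y\in V(G)$ and $A,B\subseteq V(G)$ be such that: $A\cap B=\{x,y\}$, $A\cup B=V(G)$, no edge of $G$ joins $A\setminus\{x,y\}$ to $B\setminus\{x,y\}$; $x$ and $y$ are non-adjacent in $G$ and have no common neighbour in $B$; the graph $G'$ obtained from $G[A]$ by adding the edge $xy$ is $4$-Ore; and the graph $G''$ obtained from $G[B]$ by identifying $x$ and $y$ into a new vertex $x*y$ is $4$-Ore. Then both $G'$ and $G''$ are $4$-Ore graphs with exactly four triangles, $xy$ is a diamond edge of $G'$, and $G[B]$ has exactly two triangles. Furthermore, if $G''\neq K_4$, then $x*y$ belongs to exactly two triangles of $G''$.
   Context: An Ore-composition $O(G_1,G_2)$ of vertex-disjoint graphs: delete an edge $xy$ of $G_1$; split a vertex $z$ of $G_2$ into two new nonadjacent vertices $z_1,z_2$ of positive degree whose neighbourhoods partition that of $z$; identify $x$ with $z_1$ and $y$ with $z_2$. A graph is $4$-Ore if it is obtained from a set of copies of $K_4$ by a sequence of Ore-compositions. An edge is a diamond edge if it belongs to exactly two triangles. -}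

module Defs where

open import Data.Nat using (ℕ; _<ᵇ_)
open import Data.Bool using (Bool; true; false; _∧_; if_then_else_)
open import Data.Fin using (Fin; toℕ)
open import Data.List using (List; map; allFin)
open import Data.Nat.ListAction using (sum)
open import Data.Product using (_×_; ∃)
open import Data.Sum using (_⊎_)
open import Relation.Nullary using (¬_)
open import Relation.Binary.PropositionalEquality using (_≡_; _≢_)
open import Function.Bundles using (_⇔_)

record Graph : Set where
  field
    n     : ℕ
    adj   : Fin n → Fin n → Bool
    sym   : ∀ i j → adj i j ≡ adj j i
    irr   : ∀ i → adj i i ≡ false
open Graph public

V : Graph → Set
V G = Fin (n G)

Adj : (G : Graph) → V G → V G → Set
Adj G u v = adj G u v ≡ true

PairEq : ∀ {m} → Fin m → Fin m → Fin m → Fin m → Set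
PairEq u v x y = (u ≡ x × v ≡ y) ⊎ (u ≡ y × v ≡ x)

IsK4 : Graph → Set
IsK4 G = (n G ≡ 4) × (∀ i j → (Adj G i j ⇔ (i ≢ j)))

-- H is (an isomorphic copy of) an Ore-composition O(G₁,G₂):
-- delete edge xy of G₁, split z of G₂ into z₁,z₂ (neighbourhood of z partitioned
-- by `side` into two nonempty parts), identify x with z₁ and y with z₂.
-- f embeds V(G₁) into V(H); g embeds V(G₂) ∖ {z} into V(H).
record OreComp (G₁ G₂ H : Graph) : Set where
  field
    x y     : V G₁
    xy-edge : Adj G₁ x y
    z       : V G₂
    side    : V G₂ → Bool
    f       : V G₁ → V H
    g       : V G₂ → V H
    f-inj   : ∀ u v → f u ≡ f v → u ≡ v
    g-inj   : ∀ a b → a ≢ z → b ≢ z → g a ≡ g b → a ≡ b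
    fg-disj : ∀ u a → a ≢ z → f u ≢ g a
    cover   : ∀ p → (∃ λ u → f u ≡ p) ⊎ (∃ λ a → (a ≢ z) × (g a ≡ p))
    adj-ff  : ∀ u v → (Adj H (f u) (f v) ⇔ (Adj G₁ u v × ¬ PairEq u v x y))
    adj-gg  : ∀ a b → a ≢ z → b ≢ z → adj H (g a) (g b) ≡ adj G₂ a b
    adj-fg  : ∀ u a → a ≢ z →
              (Adj H (f u) (g a) ⇔
               (Adj G₂ z a × ((u ≡ x × side a ≡ true) ⊎ (u ≡ y × side a ≡ false))))
    deg₁    : ∃ λ a → Adj G₂ z a × side a ≡ true
    deg₂    : ∃ λ a → Adj G₂ z a × side a ≡ false

data FourOre : Graph → Set where
  base : ∀ {G} → IsK4 G → FourOre G
  step : ∀ {G₁ G₂ H} → FourOre G₁ → FourOre G₂ → OreComp G₁ G₂ H → FourOre H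

Σv : ∀ {m} → (Fin m → ℕ) → ℕ
Σv {m} h = sum (map h (allFin m))

b2n : Bool → ℕ
b2n b = if b then 1 else 0

lt : ∀ {m} → Fin m → Fin m → Bool
lt i j = toℕ i <ᵇ toℕ j

triCountIn : (G : Graph) → (V G → Bool) → ℕ
triCountIn G S = Σv λ i → Σv λ j → Σv λ k →
  b2n (lt i j ∧ lt j k ∧ S i ∧ S j ∧ S k ∧ adj G i j ∧ adj G j k ∧ adj G i k)

triCount : Graph → ℕ
triCount G = triCountIn G (λ _ → true)

triAt : (G : Graph) → V G → ℕ
triAt G v = Σv λ j → Σv λ k →
  b2n (lt j k ∧ adj G v j ∧ adj G v k ∧ adj G j k)

triAtPair : (G : Graph) → V G → V G → ℕ
triAtPair G u v = Σv λ w → b2n (adj G u w ∧ adj G v w)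

DiamondEdge : (G : Graph) → V G → V G → Set
DiamondEdge G u v = Adj G u v × triAtPair G u v ≡ 2

record AddEdgeOf (G : Graph) (A : V G → Bool) (x y : V G) (H : Graph) : Set where
  field
    f      : V G → V H
    f-inj  : ∀ v w → A v ≡ true → A w ≡ true → f v ≡ f w → v ≡ w
    f-surj : ∀ p → ∃ λ v → A v ≡ true × f v ≡ p
    f-adj  : ∀ v w → A v ≡ true → A w ≡ true →
             (Adj H (f v) (f w) ⇔ (Adj G v w ⊎ PairEq v w x y))

record IdentifyOf (G : Graph) (B : V G → Bool) (x y : V G) (H : Graph) : Set where
  field
    g      : V G → V H
    g-eq   : ∀ v w → B v ≡ true → B w ≡ true →
             (g v ≡ g w ⇔ (v ≡ w ⊎ PairEq v w x y))
    g-surj : ∀ p → ∃ λ v → B v ≡ true × g v ≡ p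
    g-adj  : ∀ p q → (Adj H p q ⇔
             (∃ λ v → ∃ λ w → B v ≡ true × B w ≡ true × g v ≡ p × g w ≡ q × Adj G v w))

{-# OPTIONS --safe #-}
-- An Ore-composition deletes an edge of G₁ and splits a vertex of G₂; both are "damages", and the
-- triangles of O(G₁,G₂) are those of G₁ and of G₂ that survive the damage. A damage of the composition
-- is in turn a damage of G₁ or of G₂, except for a split at one of the two identified vertices, which
-- spares the triangles avoiding that vertex. Hence one induction shows for every 4-Ore graph: there are
-- at least 4 triangles; at least 1 avoids a given vertex, and at least 2 do unless the graph is K₄; at
-- least 2 survive any one damage, and if exactly 2 do, then there are exactly 4 triangles; if no triangle
-- survives two damages together, then exactly 2 survive either of them alone. In the theorem, G is glued
-- from G′ and G″ in the same way, so its 4 triangles are 2 survivors in G′ and 2 in G″, and the bounds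
-- are tight on both sides. A split with an empty part would leave at least 4 triangles in G″.
module Submission where

open import Defs
open import Data.Bool using (Bool; true; false; _∧_; _∨_; if_then_else_; not)
import Data.Bool.Properties as Bool
open import Data.Empty using (⊥; ⊥-elim)
open import Data.Fin using (Fin; _≟_; _<_; _<?_)
import Data.Fin.Properties as Fin
open import Data.Fin.Properties using (all?; any?)
open import Data.Fin.Subset.Properties using (anySubset?)
open import Data.List using (List; []; _∷_; _++_; map; filter; length; allFin; cartesianProduct)
open import Data.List.Membership.Propositional using (_∈_)
open import Data.List.Membership.Propositional.Properties
  using (∈-allFin; ∈-cartesianProduct⁺; ∈-filter⁺; ∈-filter⁻; ∈-map⁺; ∈-map⁻; ∈-++⁺ˡ; ∈-++⁺ʳ; ∈-++⁻)
open import Data.List.Membership.Propositional.Properties.WithK using (unique∧set⇒bag)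
open import Data.List.Properties using (length-map; length-++; filter-none; map-++; map-∘; map-cong)
open import Data.List.Relation.Binary.BagAndSetEquality using (∼bag⇒↭)
open import Data.List.Relation.Binary.Permutation.Propositional.Properties using (↭-length)
import Data.List.Relation.Unary.All as All
open import Data.List.Relation.Unary.Unique.Propositional using (Unique)
import Data.List.Relation.Unary.Unique.Propositional.Properties as Unique
open import Data.Nat using (ℕ; _+_; _*_; _≤_; z≤n; s≤s)
open import Data.Nat.ListAction using (sum)
open import Data.Nat.ListAction.Properties using (sum-++)
import Data.Nat.Properties as ℕ
open import Data.Product using (_×_; _,_; ∃; proj₁; proj₂)
open import Data.Sum using (_⊎_; inj₁; inj₂; [_,_]′; fromInj₁)
import Data.Sum as Sum
open import Data.Unit using (⊤; tt)
open import Data.Vec using (lookup; tabulate)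
open import Data.Vec.Properties using (lookup∘tabulate)
open import Function using (_∘_; id)
open import Function.Bundles using (_⇔_; mk⇔; Equivalence)
open import Relation.Binary using (tri<; tri≈; tri>)
open import Relation.Nullary using (¬_; Dec; yes; no; does)
open import Relation.Nullary.Decidable
  using (_×-dec_; _⊎-dec_; _→-dec_; ¬?; from-yes; from-no; decidable-stable)
open import Relation.Unary using (Decidable)
open import Relation.Binary.PropositionalEquality as ≡ using (_≡_; _≢_; refl; cong; cong₂; subst)

open Equivalence using (to; from)

-- Cardinalities of decidable predicates on finite types

record Finite (A : Set) : Set where
  field
    elements : List A
    unique   : Unique elements
    complete : ∀ a → a ∈ elements

finFinite : ∀ m → Finite (Fin m)
finFinite m = record { elements = allFin m ; unique = Unique.allFin⁺ m ; complete = ∈-allFin }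

×-finite : ∀ {A B} → Finite A → Finite B → Finite (A × B)
×-finite φ ψ = record
  { elements = cartesianProduct (elements φ) (elements ψ)
  ; unique   = Unique.cartesianProduct⁺ (unique φ) (unique ψ)
  ; complete = λ (a , b) → ∈-cartesianProduct⁺ (complete φ a) (complete ψ b)
  }
  where open Finite

count : ∀ {A} → Finite A → {P : A → Set} → Decidable P → ℕ
count φ P? = length (filter P? (Finite.elements φ))

module _ {A : Set} (φ : Finite A) {P : A → Set} (P? : Decidable P) where
  open Finite

  count-mono : {Q : A → Set} (Q? : Decidable Q) → (∀ a → P a → Q a) → count φ P? ≤ count φ Q?
  count-mono {Q} Q? P⇒Q = go (elements φ)
    where
    go : ∀ xs → length (filter P? xs) ≤ length (filter Q? xs)
    go []       = z≤n
    go (x ∷ xs) with P? x | Q? x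
    ... | yes p | yes q = s≤s (go xs)
    ... | yes p | no ¬q = ⊥-elim (¬q (P⇒Q x p))
    ... | no ¬p | yes q = ℕ.m≤n⇒m≤1+n (go xs)
    ... | no ¬p | no ¬q = go xs

  count-empty : (∀ a → ¬ P a) → count φ P? ≡ 0
  count-empty none = cong length (filter-none P? (All.universal none (elements φ)))

  -- The filtered lists are free of duplicates and have the same members, so they are permutations
  -- of each other. The three index types are independent: the lemma splits the triangles of a
  -- composition between its two parts, parametrises triangles by a marked vertex or edge, and, with
  -- one summand empty, transports a count along a bijection.
  count-+ : ∀ {B C} (ψ : Finite B) (χ : Finite C) {Q : B → Set} {R : C → Set}
    (Q? : Decidable Q) (R? : Decidable R) (h : B → A) (k : C → A) →
    (∀ {b b′} → h b ≡ h b′ → b ≡ b′) → (∀ {c c′} → k c ≡ k c′ → c ≡ c′) →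
    (∀ b → Q b → P (h b)) → (∀ c → R c → P (k c)) →
    (∀ b c → Q b → R c → h b ≢ k c) →
    (∀ a → P a → (∃ λ b → Q b × h b ≡ a) ⊎ (∃ λ c → R c × k c ≡ a)) →
    count φ P? ≡ count ψ Q? + count χ R?
  count-+ ψ χ {Q} {R} Q? R? h k h-inj k-inj Q⇒P R⇒P disjoint cover = begin
    length Ps                             ≡⟨ ↭-length (∼bag⇒↭ (unique∧set⇒bag
                                               (Unique.filter⁺ P? (unique φ)) QRs! (mk⇔ Ps⊆QRs QRs⊆Ps))) ⟩
    length (map h Qs ++ map k Rs)         ≡⟨ length-++ (map h Qs) ⟩
    length (map h Qs) + length (map k Rs) ≡⟨ cong₂ _+_ (length-map h Qs) (length-map k Rs) ⟩
    length Qs + length Rs                 ∎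
    where
    open ≡.≡-Reasoning
    Ps = filter P? (elements φ)
    Qs = filter Q? (elements ψ)
    Rs = filter R? (elements χ)
    in-Q : ∀ {b} → b ∈ Qs → Q b
    in-Q = proj₂ ∘ ∈-filter⁻ Q? {xs = elements ψ}
    in-R : ∀ {c} → c ∈ Rs → R c
    in-R = proj₂ ∘ ∈-filter⁻ R? {xs = elements χ}
    QRs! : Unique (map h Qs ++ map k Rs)
    QRs! = Unique.++⁺ (Unique.map⁺ h-inj (Unique.filter⁺ Q? (unique ψ)))
      (Unique.map⁺ k-inj (Unique.filter⁺ R? (unique χ)))
      λ (p , q) → let b , b∈ , a≡hb = ∈-map⁻ h p
                      c , c∈ , a≡kc = ∈-map⁻ k q
                  in disjoint b c (in-Q b∈) (in-R c∈) (≡.trans (≡.sym a≡hb) a≡kc)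
    Ps⊆QRs : ∀ {a} → a ∈ Ps → a ∈ map h Qs ++ map k Rs
    Ps⊆QRs {a} a∈ with cover a (proj₂ (∈-filter⁻ P? {xs = elements φ} a∈))
    ... | inj₁ (b , q , refl) = ∈-++⁺ˡ (∈-map⁺ h (∈-filter⁺ Q? (complete ψ b) q))
    ... | inj₂ (c , r , refl) = ∈-++⁺ʳ (map h Qs) (∈-map⁺ k (∈-filter⁺ R? (complete χ c) r))
    QRs⊆Ps : ∀ {a} → a ∈ map h Qs ++ map k Rs → a ∈ Ps
    QRs⊆Ps {a} a∈ with ∈-++⁻ (map h Qs) a∈
    ... | inj₁ q with b , b∈ , refl ← ∈-map⁻ h q = ∈-filter⁺ P? (complete φ a) (Q⇒P b (in-Q b∈))
    ... | inj₂ r with c , c∈ , refl ← ∈-map⁻ k r = ∈-filter⁺ P? (complete φ a) (R⇒P c (in-R c∈))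

  count-⊎ : {Q R : A → Set} (Q? : Decidable Q) (R? : Decidable R) →
    (∀ a → Q a → P a) → (∀ a → R a → P a) → (∀ a → Q a → ¬ R a) → (∀ a → P a → Q a ⊎ R a) →
    count φ P? ≡ count φ Q? + count φ R?
  count-⊎ Q? R? Q⇒P R⇒P disjoint cover = count-+ φ φ Q? R? id id id id Q⇒P R⇒P
    (λ { a _ q r refl → disjoint a q r })
    (λ a p → Sum.map (λ q → a , q , refl) (λ r → a , r , refl) (cover a p))

count-cong : ∀ {A} (φ : Finite A) {P Q : A → Set} (P? : Decidable P) (Q? : Decidable Q) →
  (∀ a → P a → Q a) → (∀ a → Q a → P a) → count φ P? ≡ count φ Q?
count-cong φ P? Q? P⇒Q Q⇒P = ℕ.≤-antisym (count-mono φ P? Q? P⇒Q) (count-mono φ Q? P? Q⇒P)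

Triple : ℕ → Set
Triple m = Fin m × Fin m × Fin m

triples : ∀ m → Finite (Triple m)
triples m = ×-finite (finFinite m) (×-finite (finFinite m) (finFinite m))

rotate : ∀ {m} → Triple m → Triple m
rotate (i , j , k) = (j , k , i)

mapT : ∀ {m m′} → (Fin m → Fin m′) → Triple m → Triple m′
mapT f (i , j , k) = (f i , f j , f k)

triple-≡ : ∀ {m} {i j k i′ j′ k′ : Fin m} → i ≡ i′ → j ≡ j′ → k ≡ k′ → (i , j , k) ≡ (i′ , j′ , k′)
triple-≡ refl refl refl = refl

-- Triangles and damages

Adj? : (G : Graph) (u v : V G) → Dec (Adj G u v)
Adj? G u v = adj G u v Bool.≟ true

Adj-sym : (G : Graph) {u v : V G} → Adj G u v → Adj G v u
Adj-sym G {u} {v} e = ≡.trans (Graph.sym G v u) e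

Adj-irrefl : (G : Graph) {u v : V G} → Adj G u v → u ≢ v
Adj-irrefl G {u} e refl with () ← ≡.trans (≡.sym e) (irr G u)

Tri : (G : Graph) → Triple (n G) → Set
Tri G (i , j , k) = Adj G i j × Adj G j k × Adj G k i

Tri? : (G : Graph) → Decidable (Tri G)
Tri? G (i , j , k) = Adj? G i j ×-dec Adj? G j k ×-dec Adj? G k i

Tri-rotate : (G : Graph) (t : Triple (n G)) → Tri G t → Tri G (rotate t)
Tri-rotate G t (ij , jk , ki) = jk , ki , ij

-- Every triangle is counted six times, once for each ordering of its vertices.
#Tri : (G : Graph) {α : Triple (n G) → Set} → Decidable α → ℕ
#Tri G α? = count (triples (n G)) (λ t → Tri? G t ×-dec α? t)

module _ (G : Graph) {α β : Triple (n G) → Set} (α? : Decidable α) (β? : Decidable β) where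

  #Tri-mono : (∀ t → Tri G t → α t → β t) → #Tri G α? ≤ #Tri G β?
  #Tri-mono α⇒β = count-mono (triples (n G)) _ _ λ t (tri , a) → tri , α⇒β t tri a

  #Tri-cong : (∀ t → Tri G t → α t → β t) → (∀ t → Tri G t → β t → α t) → #Tri G α? ≡ #Tri G β?
  #Tri-cong α⇒β β⇒α = count-cong (triples (n G)) _ _
    (λ t (tri , a) → tri , α⇒β t tri a) (λ t (tri , b) → tri , β⇒α t tri b)

All? : ∀ {m} → Decidable {A = Triple m} (λ _ → ⊤)
All? _ = yes tt

module _ {m : ℕ} where

  Avoids : Fin m → Triple m → Set
  Avoids v (i , j , k) = i ≢ v × j ≢ v × k ≢ v

  Avoids? : ∀ v → Decidable (Avoids v)
  Avoids? v (i , j , k) = ¬? (i ≟ v) ×-dec ¬? (j ≟ v) ×-dec ¬? (k ≟ v)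

  PairEq? : (a b u v : Fin m) → Dec (PairEq a b u v)
  PairEq? a b u v = ((a ≟ u) ×-dec (b ≟ v)) ⊎-dec ((a ≟ v) ×-dec (b ≟ u))

  -- edge u v deletes the edge uv; split z s splits z, joining its neighbour a to the half named s a.
  data Damage : Set where
    edge  : (u v : Fin m) → Damage
    split : (z : Fin m) (s : Fin m → Bool) → Damage

  -- What the damage demands at the corner c of a triangle c a b for it to survive.
  Corner : Damage → Triple m → Set
  Corner (edge u v)  (c , a , b) = ¬ PairEq a b u v
  Corner (split z s) (c , a , b) = c ≡ z → s a ≡ s b

  Corner? : ∀ d → Decidable (Corner d)
  Corner? (edge u v)  (c , a , b) = ¬? (PairEq? a b u v)
  Corner? (split z s) (c , a , b) = (c ≟ z) →-dec (s a Bool.≟ s b)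

  Alive : Damage → Triple m → Set
  Alive d t = Corner d t × Corner d (rotate t) × Corner d (rotate (rotate t))

  Alive? : ∀ d → Decidable (Alive d)
  Alive? d t = Corner? d t ×-dec Corner? d (rotate t) ×-dec Corner? d (rotate (rotate t))

  Alive-rotate : ∀ d t → Alive d t → Alive d (rotate t)
  Alive-rotate d t (p , q , r) = q , r , p

  _∩?_ : {α β : Triple m → Set} → Decidable α → Decidable β → Decidable (λ t → α t × β t)
  (α? ∩? β?) t = α? t ×-dec β? t

Proper : (G : Graph) → Damage {n G} → Set
Proper G (edge u v)  = Adj G u v
Proper G (split z s) = (∃ λ a → Adj G z a × s a ≡ true) × (∃ λ a → Adj G z a × s a ≡ false)

-- Compositions and the origin of their triangles

-- An Ore-composition in which one of the two parts of the neighbourhood of z may be empty.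
record Gluing (G₁ G₂ H : Graph) : Set where
  field
    x y     : V G₁
    z       : V G₂
    side    : V G₂ → Bool
    x≢y     : x ≢ y
    f       : V G₁ → V H
    g       : V G₂ → V H
    f-inj   : ∀ u v → f u ≡ f v → u ≡ v
    g-inj   : ∀ a b → a ≢ z → b ≢ z → g a ≡ g b → a ≡ b
    fg-disj : ∀ u a → a ≢ z → f u ≢ g a
    cover   : ∀ p → (∃ λ u → f u ≡ p) ⊎ (∃ λ a → (a ≢ z) × (g a ≡ p))
    adj-ff  : ∀ u v → (Adj H (f u) (f v) ⇔ (Adj G₁ u v × ¬ PairEq u v x y))
    adj-gg  : ∀ a b → a ≢ z → b ≢ z → adj H (g a) (g b) ≡ adj G₂ a b
    adj-fg  : ∀ u a → a ≢ z →
              (Adj H (f u) (g a) ⇔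
               (Adj G₂ z a × ((u ≡ x × side a ≡ true) ⊎ (u ≡ y × side a ≡ false))))

  damage₁ : Damage
  damage₁ = edge x y

  damage₂ : Damage
  damage₂ = split z side

  split-end : Bool → V G₁
  split-end b = if b then x else y

  -- The image in H of the vertex a of G₂, seen from its neighbour b.
  lift : V G₂ → V G₂ → V H
  lift a b = if does (a ≟ z) then f (split-end (side b)) else g a

  -- Each vertex is seen from its successor in the cyclic order, so `liftT` commutes with `rotate`
  -- by definition.
  liftT : Triple (n G₂) → Triple (n H)
  liftT (a , b , c) = lift a b , lift b c , lift c a

  -- Contracts the copy of `G₁` to `z` and undoes `g` elsewhere. It is a left inverse of `lift`,
  -- whatever the neighbour; the injectivity of `liftT` and the pulling back of damages to `G₂` rest
  -- on this.
  π : V H → V G₂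
  π p = [ (λ _ → z) , proj₁ ]′ (cover p)

  π-f : ∀ u → π (f u) ≡ z
  π-f u with cover (f u)
  ... | inj₁ _             = refl
  ... | inj₂ (a , a≢z , e) = ⊥-elim (fg-disj u a a≢z (≡.sym e))

  π-g : ∀ {a} → a ≢ z → π (g a) ≡ a
  π-g {a} a≢z with cover (g a)
  ... | inj₁ (u , e)       = ⊥-elim (fg-disj u a a≢z e)
  ... | inj₂ (b , b≢z , e) = g-inj b a b≢z a≢z e

  lift-z : ∀ b → lift z b ≡ f (split-end (side b))
  lift-z b with z ≟ z
  ... | yes _  = refl
  ... | no z≢z = ⊥-elim (z≢z refl)

  lift-g : ∀ {a} b → a ≢ z → lift a b ≡ g a
  lift-g {a} b a≢z with a ≟ z
  ... | yes a≡z = ⊥-elim (a≢z a≡z)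
  ... | no _    = refl

  π-lift : ∀ a b → π (lift a b) ≡ a
  π-lift a b with a ≟ z
  ... | yes a≡z = ≡.trans (π-f _) (≡.sym a≡z)
  ... | no a≢z  = π-g a≢z

  lift≡f⇒z : ∀ {a b u} → lift a b ≡ f u → a ≡ z
  lift≡f⇒z {a} {b} {u} e = ≡.trans (≡.sym (π-lift a b)) (≡.trans (cong π e) (π-f u))

  lift≡f⇒end : ∀ {a b u} → lift a b ≡ f u → u ≡ x ⊎ u ≡ y
  lift≡f⇒end {a} {b} {u} e with refl ← lift≡f⇒z {a} {b} e
    with side b | f-inj _ _ (≡.trans (≡.sym (lift-z b)) e)
  ... | true  | eq = inj₁ (≡.sym eq)
  ... | false | eq = inj₂ (≡.sym eq)

  split-end-fg : ∀ {a} → a ≢ z → Adj G₂ z a → Adj H (f (split-end (side a))) (g a)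
  split-end-fg {a} a≢z za with side a in eq
  ... | true  = from (adj-fg x a a≢z) (za , inj₁ (refl , eq))
  ... | false = from (adj-fg y a a≢z) (za , inj₂ (refl , eq))

  fg-split-end : ∀ {u a} → a ≢ z → Adj H (f u) (g a) → Adj G₂ z a × u ≡ split-end (side a)
  fg-split-end {u} {a} a≢z e with to (adj-fg u a a≢z) e
  ... | za , inj₁ (refl , s) = za , cong split-end (≡.sym s)
  ... | za , inj₂ (refl , s) = za , cong split-end (≡.sym s)

  lift-adj : ∀ {a b} → Adj G₂ a b → Adj H (lift a b) (lift b a)
  lift-adj {a} {b} ab with a ≟ z | b ≟ z
  ... | yes refl | yes refl = ⊥-elim (Adj-irrefl G₂ ab refl)
  ... | yes refl | no b≢z   = split-end-fg b≢z ab
  ... | no a≢z   | yes refl = Adj-sym H (split-end-fg a≢z (Adj-sym G₂ ab))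
  ... | no a≢z   | no b≢z   = ≡.trans (adj-gg a b a≢z b≢z) ab

  -- Only the lift of `z` depends on the neighbour, and a surviving corner at `z` has both
  -- neighbours in the same half.
  lift-corner : ∀ {a b c} → Corner damage₂ (a , b , c) → lift a b ≡ lift a c
  lift-corner {a} κ with a ≟ z
  ... | yes a≡z = cong (f ∘ split-end) (κ a≡z)
  ... | no _    = refl

  mapT-Tri : ∀ t → Tri G₁ t → Alive damage₁ t → Tri H (mapT f t)
  mapT-Tri (i , j , k) (ij , jk , ki) (κi , κj , κk) =
    from (adj-ff i j) (ij , κk) , from (adj-ff j k) (jk , κi) , from (adj-ff k i) (ki , κj)

  liftT-Tri : ∀ t → Tri G₂ t → Alive damage₂ t → Tri H (liftT t)
  liftT-Tri (a , b , c) (ab , bc , ca) (κa , κb , κc) =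
    -- `lift-adj` sees each end of an edge from the other end; the surviving corner at the second
    -- end replaces that view by the one from its successor.
    subst (Adj H (lift a b)) (≡.sym (lift-corner κb)) (lift-adj ab) ,
    subst (Adj H (lift b c)) (≡.sym (lift-corner κc)) (lift-adj bc) ,
    subst (Adj H (lift c a)) (≡.sym (lift-corner κa)) (lift-adj ca)

  -- A vertex `g a` has at most one neighbour in the copy of `G₁`, namely the end selected by
  -- `side a`.
  no-ffg : ∀ {u v a} → a ≢ z → Adj H (f u) (f v) → Adj H (f v) (g a) → Adj H (g a) (f u) → ⊥
  no-ffg a≢z uv va au = Adj-irrefl H uv (cong f (≡.trans
    (proj₂ (fg-split-end a≢z (Adj-sym H au))) (≡.sym (proj₂ (fg-split-end a≢z va)))))

  split-end-injective : ∀ {b c} → split-end b ≡ split-end c → b ≡ c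
  split-end-injective {true}  {true}  _ = refl
  split-end-injective {false} {false} _ = refl
  split-end-injective {true}  {false} e = ⊥-elim (x≢y e)
  split-end-injective {false} {true}  e = ⊥-elim (x≢y (≡.sym e))

  Lifted : Triple (n H) → Set
  Lifted p = ∃ λ t → Tri G₂ t × Alive damage₂ t × liftT t ≡ p

  Lifted-rotate : ∀ {p} → Lifted p → Lifted (rotate p)
  Lifted-rotate (t , tri , al , refl) = rotate t , Tri-rotate G₂ t tri , Alive-rotate damage₂ t al , refl

  -- Both `a` and `b` are attached to the same end `u`. As the two ends are distinct, `a` and `b`
  -- lie in the same half, so the triangle `z a b` of `G₂` survives the split.
  fgg-Lifted : ∀ {u a b} → a ≢ z → b ≢ z → Tri H (f u , g a , g b) → Lifted (f u , g a , g b)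
  fgg-Lifted {u} {a} {b} a≢z b≢z (ua , ab , bu) =
    (z , a , b) ,
    (za , ≡.trans (≡.sym (adj-gg a b a≢z b≢z)) ab , Adj-sym G₂ zb) ,
    ((λ _ → split-end-injective (≡.trans (≡.sym ua-end) ub-end)) , ⊥-elim ∘ a≢z , ⊥-elim ∘ b≢z) ,
    triple-≡ (≡.trans (lift-z a) (cong f (≡.sym ua-end))) (lift-g b a≢z) (lift-g z b≢z)
    where
    za     = proj₁ (fg-split-end a≢z ua)
    ua-end = proj₂ (fg-split-end a≢z ua)
    zb     = proj₁ (fg-split-end b≢z (Adj-sym H bu))
    ub-end = proj₂ (fg-split-end b≢z (Adj-sym H bu))

  -- Cases by the number of vertices in the copy of `G₁`: with three the triangle comes from `G₁`,
  -- two are impossible by `no-ffg`, and with one or none it comes from `G₂`.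
  Tri-H : ∀ p → Tri H p → (∃ λ t → Tri G₁ t × Alive damage₁ t × mapT f t ≡ p) ⊎ Lifted p
  Tri-H (p , q , r) tri@(pq , qr , rp) with cover p | cover q | cover r
  ... | inj₁ (u , refl) | inj₁ (v , refl) | inj₁ (w , refl) =
    inj₁ ((u , v , w) , (proj₁ uv , proj₁ vw , proj₁ wu) , (proj₂ vw , proj₂ wu , proj₂ uv) , refl)
    where
    uv = to (adj-ff u v) pq
    vw = to (adj-ff v w) qr
    wu = to (adj-ff w u) rp
  ... | inj₁ (u , refl) | inj₁ (v , refl) | inj₂ (a , a≢z , refl) = ⊥-elim (no-ffg a≢z pq qr rp)
  ... | inj₁ (u , refl) | inj₂ (a , a≢z , refl) | inj₁ (v , refl) = ⊥-elim (no-ffg a≢z rp pq qr)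
  ... | inj₂ (a , a≢z , refl) | inj₁ (u , refl) | inj₁ (v , refl) = ⊥-elim (no-ffg a≢z qr rp pq)
  ... | inj₁ (u , refl) | inj₂ (a , a≢z , refl) | inj₂ (b , b≢z , refl) =
    inj₂ (fgg-Lifted a≢z b≢z tri)
  ... | inj₂ (b , b≢z , refl) | inj₁ (u , refl) | inj₂ (a , a≢z , refl) =
    inj₂ (Lifted-rotate (Lifted-rotate (fgg-Lifted a≢z b≢z (qr , rp , pq))))
  ... | inj₂ (a , a≢z , refl) | inj₂ (b , b≢z , refl) | inj₁ (u , refl) =
    inj₂ (Lifted-rotate (fgg-Lifted a≢z b≢z (rp , pq , qr)))
  ... | inj₂ (a , a≢z , refl) | inj₂ (b , b≢z , refl) | inj₂ (c , c≢z , refl) =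
    inj₂ ((a , b , c) ,
      (≡.trans (≡.sym (adj-gg a b a≢z b≢z)) pq ,
       ≡.trans (≡.sym (adj-gg b c b≢z c≢z)) qr ,
       ≡.trans (≡.sym (adj-gg c a c≢z a≢z)) rp) ,
      (⊥-elim ∘ a≢z , ⊥-elim ∘ b≢z , ⊥-elim ∘ c≢z) ,
      triple-≡ (lift-g b a≢z) (lift-g c b≢z) (lift-g a c≢z))

  mapT-injective : ∀ {s t} → mapT f s ≡ mapT f t → s ≡ t
  mapT-injective e = triple-≡ (f-inj _ _ (cong proj₁ e)) (f-inj _ _ (cong (proj₁ ∘ proj₂) e))
    (f-inj _ _ (cong (proj₂ ∘ proj₂) e))

  liftT-injective : ∀ {s t} → liftT s ≡ liftT t → s ≡ t
  liftT-injective {a , b , c} {a′ , b′ , c′} e = triple-≡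
    (unlift (cong proj₁ e)) (unlift (cong (proj₁ ∘ proj₂) e)) (unlift (cong (proj₂ ∘ proj₂) e))
    where
    unlift : ∀ {a b a′ b′} → lift a b ≡ lift a′ b′ → a ≡ a′
    unlift {a} {b} {a′} {b′} e = ≡.trans (≡.sym (π-lift a b)) (≡.trans (cong π e) (π-lift a′ b′))

  -- Two adjacent vertices of `G₂` are not both `z`. Hence a lifted triangle has at most one vertex
  -- in the copy of `G₁`, and it is never the image of a triangle of `G₁`.
  lift-not-ff : ∀ {a b c d u v} → Adj G₂ a b → lift a c ≡ f u → lift b d ≡ f v → ⊥
  lift-not-ff {a} {b} {c} {d} ab p q =
    Adj-irrefl G₂ ab (≡.trans (lift≡f⇒z {a} {c} p) (≡.sym (lift≡f⇒z {b} {d} q)))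

  -- The identity behind every count in a composition. The predicate `α` is left free because it is
  -- taken to be avoidance of a vertex, survival of one or of two further damages, and containment
  -- in a vertex set.
  #Tri-H : {α : Triple (n H) → Set} (α? : Decidable α) →
    #Tri H α? ≡ #Tri G₁ (Alive? damage₁ ∩? (α? ∘ mapT f)) + #Tri G₂ (Alive? damage₂ ∩? (α? ∘ liftT))
  #Tri-H {α} α? = count-+ (triples (n H)) _ (triples (n G₁)) (triples (n G₂)) _ _
    (mapT f) liftT mapT-injective liftT-injective
    (λ t (tri , al , a) → mapT-Tri t tri al , a)
    (λ t (tri , al , a) → liftT-Tri t tri al , a)
    (λ (u , v , w) (a , b , c) _ ((ab , _) , _) e →
      lift-not-ff {a} {b} ab (≡.sym (cong proj₁ e)) (≡.sym (cong (proj₁ ∘ proj₂) e)))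
    cover-H
    where
    cover-H : ∀ p → Tri H p × α p →
      (∃ λ t → (Tri G₁ t × Alive damage₁ t × α (mapT f t)) × mapT f t ≡ p) ⊎
      (∃ λ t → (Tri G₂ t × Alive damage₂ t × α (liftT t)) × liftT t ≡ p)
    cover-H p (tri , a) with Tri-H p tri
    ... | inj₁ (t , tri₁ , al , refl) = inj₁ (t , (tri₁ , al , a) , refl)
    ... | inj₂ (t , tri₂ , al , refl) = inj₂ (t , (tri₂ , al , a) , refl)

-- The sums triCountIn, triAt and triAtPair as counts of ordered triangles

∧⁺ : ∀ {a b} → a ≡ true → b ≡ true → a ∧ b ≡ true
∧⁺ refl refl = refl

∧⁻ : ∀ {a b} → a ∧ b ≡ true → a ≡ true × b ≡ true
∧⁻ {true} {true} refl = refl , refl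

∧⇔ : ∀ {a b} {P Q : Set} → (a ≡ true) ⇔ P → (b ≡ true) ⇔ Q → (a ∧ b ≡ true) ⇔ (P × Q)
∧⇔ p q = mk⇔ (λ e → to p (proj₁ (∧⁻ e)) , to q (proj₂ (∧⁻ e))) (λ (a , b) → ∧⁺ (from p a) (from q b))

≡⇔ : ∀ {b} → (b ≡ true) ⇔ (b ≡ true)
≡⇔ = mk⇔ id id

lt⇔< : ∀ {m} {i j : Fin m} → (lt i j ≡ true) ⇔ (i < j)
lt⇔< {i = i} {j} = mk⇔
  (ℕ.<ᵇ⇒< _ _ ∘ from Bool.T-≡)
  (to Bool.T-≡ ∘ ℕ.<⇒<ᵇ)

count≡sum : ∀ {A} (φ : Finite A) {P : A → Set} (P? : Decidable P) (F : A → Bool) →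
  (∀ a → (F a ≡ true) ⇔ P a) → count φ P? ≡ sum (map (b2n ∘ F) (Finite.elements φ))
count≡sum φ P? F F⇔P = go (Finite.elements φ)
  where
  go : ∀ xs → length (filter P? xs) ≡ sum (map (b2n ∘ F) xs)
  go []       = refl
  go (x ∷ xs) with P? x | F x | F⇔P x
  ... | yes p | true  | _ = cong ℕ.suc (go xs)
  ... | yes p | false | e with () ← from e p
  ... | no ¬p | true  | e = ⊥-elim (¬p (to e refl))
  ... | no ¬p | false | _ = go xs

sum-cartesianProduct : ∀ {A B : Set} (h : A × B → ℕ) xs ys →
  sum (map h (cartesianProduct xs ys)) ≡ sum (map (λ a → sum (map (λ b → h (a , b)) ys)) xs)
sum-cartesianProduct h []       ys = refl
sum-cartesianProduct h (x ∷ xs) ys = begin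
  sum (map h (map (x ,_) ys ++ cartesianProduct xs ys))
    ≡⟨ cong sum (map-++ h (map (x ,_) ys) _) ⟩
  sum (map h (map (x ,_) ys) ++ map h (cartesianProduct xs ys))
    ≡⟨ sum-++ (map h (map (x ,_) ys)) _ ⟩
  sum (map h (map (x ,_) ys)) + sum (map h (cartesianProduct xs ys))
    ≡⟨ cong₂ _+_ (cong sum (≡.sym (map-∘ ys))) (sum-cartesianProduct h xs ys) ⟩
  sum (map (λ b → h (x , b)) ys) + sum (map (λ a → sum (map (λ b → h (a , b)) ys)) xs) ∎
  where open ≡.≡-Reasoning

pairs : ∀ m → Finite (Fin m × Fin m)
pairs m = ×-finite (finFinite m) (finFinite m)

module _ (G : Graph) where

  private
    Ts = triples (n G)

  triCountIn≡count : ∀ S {P : Triple (n G) → Set} (P? : Decidable P) →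
    (∀ i j k → (lt i j ∧ lt j k ∧ S i ∧ S j ∧ S k ∧ adj G i j ∧ adj G j k ∧ adj G i k ≡ true) ⇔ P (i , j , k)) →
    count Ts P? ≡ triCountIn G S
  triCountIn≡count S P? F⇔P = ≡.trans
    (count≡sum Ts P? (λ (i , j , k) → lt i j ∧ lt j k ∧ S i ∧ S j ∧ S k ∧ adj G i j ∧ adj G j k ∧ adj G i k)
      (λ (i , j , k) → F⇔P i j k))
    (≡.trans (sum-cartesianProduct _ (allFin (n G)) _)
      (cong sum (map-cong (λ i → sum-cartesianProduct _ (allFin (n G)) (allFin (n G))) (allFin (n G)))))

  triAt≡count : ∀ v {P : V G × V G → Set} (P? : Decidable P) →
    (∀ j k → (lt j k ∧ adj G v j ∧ adj G v k ∧ adj G j k ≡ true) ⇔ P (j , k)) →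
    count (pairs (n G)) P? ≡ triAt G v
  triAt≡count v P? F⇔P = ≡.trans
    (count≡sum (pairs (n G)) P? (λ (j , k) → lt j k ∧ adj G v j ∧ adj G v k ∧ adj G j k) (λ (j , k) → F⇔P j k))
    (sum-cartesianProduct _ (allFin (n G)) (allFin (n G)))

  #Tri-rotate : {α : Triple (n G) → Set} (α? : Decidable α) → #Tri G (α? ∘ rotate) ≡ #Tri G α?
  #Tri-rotate {α} α? = ≡.trans
    -- The second summand is empty, so `count-+` acts as a bijection principle; the bijection is the
    -- inverse of `rotate`.
    (count-+ Ts _ Ts Ts (λ t → Tri? G t ×-dec α? t) none? (rotate ∘ rotate) id (λ { refl → refl }) id
      (λ t (tri , a) → Tri-rotate G _ (Tri-rotate G t tri) , a) (λ _ ()) (λ _ _ _ ())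
      (λ t (tri , a) → inj₁ (rotate t , (Tri-rotate G t tri , a) , refl)))
    (≡.trans (cong (#Tri G α? +_) (count-empty Ts none? (λ _ ()))) (ℕ.+-identityʳ (#Tri G α?)))
    where
    none? : Decidable {A = Triple (n G)} (λ _ → ⊥)
    none? _ = no id

  module _ {Q : Triple (n G) → Set} (Q? : Decidable Q)
           (exclusive : ∀ t → Tri G t → Q t → ¬ Q (rotate t)) where

    -- By `exclusive`, at most one of the three rotations of a triangle satisfies the mark `Q`. The
    -- triangles with a marked rotation therefore fall into three classes, carried to one another by
    -- rotation and so of equal size; `β` describes the triangles without one.
    #Tri-thrice : {α β : Triple (n G) → Set} (α? : Decidable α) (β? : Decidable β) →
      (∀ t → α t → α (rotate t)) →
      (∀ t → Tri G t → β t ⇔ (α t × ¬ Q t × ¬ Q (rotate t) × ¬ Q (rotate (rotate t)))) →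
      #Tri G α? ≡ #Tri G β? + 3 * #Tri G (α? ∩? Q?)
    #Tri-thrice {α} {β} α? β? α-rotate β⇔ = begin
      #Tri G α?
        ≡⟨ count-⊎ Ts _ _ _ (λ { t (tri , b) → tri , proj₁ (to (β⇔ t tri) b) }) (λ { t (tri , a , _) → tri , a })
             (λ { t (tri , b) (_ , _ , q) → let _ , q₁ , q₂ , q₃ = to (β⇔ t tri) b in [ q₁ , [ q₂ , q₃ ]′ ]′ q })
             cover ⟩
      #Tri G β? + #Tri G (α? ∩? some?)
        ≡⟨ cong (#Tri G β? +_) (count-⊎ Ts _ _ _
             (λ { t (tri , a , q) → tri , a , inj₁ q }) (λ { t (tri , a , q) → tri , a , inj₂ q })
             (λ { t (tri , _ , q) (_ , _ , inj₁ q′) → exclusive t tri q q′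
                ; t (tri , _ , q) (_ , _ , inj₂ q′) → exclusive _ (Tri-rotate G _ (Tri-rotate G t tri)) q′ q })
             (λ { t (tri , a , inj₁ q) → inj₁ (tri , a , q) ; t (tri , a , inj₂ q) → inj₂ (tri , a , q) })) ⟩
      #Tri G β? + (#Tri G (α? ∩? Q?) + #Tri G (α? ∩? some′?))
        ≡⟨ cong (λ c → #Tri G β? + (#Tri G (α? ∩? Q?) + c)) (count-⊎ Ts _ _ _
             (λ { t (tri , a , q) → tri , a , inj₁ q }) (λ { t (tri , a , q) → tri , a , inj₂ q })
             (λ { t (tri , _ , q) (_ , _ , q′) → exclusive _ (Tri-rotate G t tri) q q′ })
             (λ { t (tri , a , inj₁ q) → inj₁ (tri , a , q) ; t (tri , a , inj₂ q) → inj₂ (tri , a , q) })) ⟩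
      #Tri G β? + (#Tri G (α? ∩? Q?) + (#Tri G (α? ∩? (Q? ∘ rotate)) + #Tri G (α? ∩? (Q? ∘ rotate ∘ rotate))))
        ≡⟨ cong₂ (λ c d → #Tri G β? + (#Tri G (α? ∩? Q?) + (c + d))) once twice ⟩
      #Tri G β? + (#Tri G (α? ∩? Q?) + (#Tri G (α? ∩? Q?) + #Tri G (α? ∩? Q?)))
        ≡⟨ cong (λ c → #Tri G β? + (#Tri G (α? ∩? Q?) + (#Tri G (α? ∩? Q?) + c))) (≡.sym (ℕ.+-identityʳ _)) ⟩
      #Tri G β? + 3 * #Tri G (α? ∩? Q?) ∎
      where
      open ≡.≡-Reasoning
      some′? = λ t → Q? (rotate t) ⊎-dec Q? (rotate (rotate t))
      some?  = λ t → Q? t ⊎-dec some′? t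
      once : #Tri G (α? ∩? (Q? ∘ rotate)) ≡ #Tri G (α? ∩? Q?)
      once = ≡.trans
        (#Tri-cong G _ _ (λ t _ (a , q) → α-rotate t a , q) (λ t _ (a , q) → α-rotate _ (α-rotate _ a) , q))
        (#Tri-rotate (α? ∩? Q?))
      twice : #Tri G (α? ∩? (Q? ∘ rotate ∘ rotate)) ≡ #Tri G (α? ∩? Q?)
      twice = ≡.trans
        (#Tri-cong G _ _ (λ t _ (a , q) → α-rotate t a , q) (λ t _ (a , q) → α-rotate _ (α-rotate _ a) , q))
        (≡.trans (#Tri-rotate (α? ∩? (Q? ∘ rotate))) once)
      cover : ∀ t → Tri G t × α t → (Tri G t × β t) ⊎ (Tri G t × α t × (Q t ⊎ Q (rotate t) ⊎ Q (rotate (rotate t))))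
      cover t (tri , a) with some? t
      ... | yes q = inj₂ (tri , a , q)
      ... | no ¬q = inj₁ (tri , from (β⇔ t tri) (a , ¬q ∘ inj₁ , ¬q ∘ inj₂ ∘ inj₁ , ¬q ∘ inj₂ ∘ inj₂))

  thrice-twice : ∀ c → 3 * (c + c) ≡ 6 * c
  thrice-twice c = ≡.trans (cong (λ k → 3 * (c + k)) (≡.sym (ℕ.+-identityʳ c))) (≡.sym (ℕ.*-assoc 3 2 c))

  -- The mark is that `v` comes first. The factor 6 is 3 for the rotations times 2 for the order of
  -- the other two vertices.
  #Tri-triAt : ∀ v → #Tri G All? ≡ #Tri G (Avoids? v) + 6 * triAt G v
  #Tri-triAt v = begin
    #Tri G All?
      ≡⟨ #Tri-thrice at? (λ { t (ij , _) i≡v j≡v → Adj-irrefl G ij (≡.trans i≡v (≡.sym j≡v)) })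
           All? (Avoids? v) (λ _ _ → tt) (λ t _ → mk⇔ (tt ,_) proj₂) ⟩
    #Tri G (Avoids? v) + 3 * #Tri G (All? ∩? at?)
      ≡⟨ cong (λ c → #Tri G (Avoids? v) + 3 * c) (count-+ Ts _ (pairs (n G)) (pairs (n G)) wedge? wedge?
           (λ (j , k) → v , j , k) (λ (j , k) → v , k , j) (λ { refl → refl }) (λ { refl → refl })
           (λ (j , k) (_ , vj , vk , jk) → (vj , jk , Adj-sym G vk) , tt , refl)
           (λ (j , k) (_ , vj , vk , jk) → (vk , Adj-sym G jk , Adj-sym G vj) , tt , refl)
           (λ { (j , k) _ (j<k , _) (k<j , _) refl → Fin.<-asym j<k k<j })
           cover) ⟩
    #Tri G (Avoids? v) + 3 * (count (pairs (n G)) wedge? + count (pairs (n G)) wedge?)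
      ≡⟨ cong (#Tri G (Avoids? v) +_) (thrice-twice (count (pairs (n G)) wedge?)) ⟩
    #Tri G (Avoids? v) + 6 * count (pairs (n G)) wedge?
      ≡⟨ cong (λ c → #Tri G (Avoids? v) + 6 * c)
           (triAt≡count v wedge? (λ j k → ∧⇔ (lt⇔< {i = j} {k}) (∧⇔ ≡⇔ (∧⇔ ≡⇔ ≡⇔)))) ⟩
    #Tri G (Avoids? v) + 6 * triAt G v ∎
    where
    open ≡.≡-Reasoning
    at? : Decidable {A = Triple (n G)} (λ t → proj₁ t ≡ v)
    at? t = proj₁ t ≟ v
    Wedge : V G × V G → Set
    Wedge (j , k) = j < k × Adj G v j × Adj G v k × Adj G j k
    wedge? : Decidable Wedge
    wedge? (j , k) = j <? k ×-dec Adj? G v j ×-dec Adj? G v k ×-dec Adj? G j k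
    cover : ∀ t → Tri G t × ⊤ × proj₁ t ≡ v →
      (∃ λ (j , k) → Wedge (j , k) × (v , j , k) ≡ t) ⊎ (∃ λ (j , k) → Wedge (j , k) × (v , k , j) ≡ t)
    cover (_ , j , k) ((vj , jk , kv) , _ , refl) with Fin.<-cmp j k
    ... | tri< j<k _ _ = inj₁ ((j , k) , (j<k , vj , Adj-sym G kv , jk) , refl)
    ... | tri≈ _ j≡k _ = ⊥-elim (Adj-irrefl G jk j≡k)
    ... | tri> _ _ k<j = inj₂ ((k , j) , (k<j , Adj-sym G kv , vj , Adj-sym G jk) , refl)

  -- The mark is that the side opposite the first vertex is `uv`; the triangles without it are those
  -- surviving the deletion of `uv`. Each apex occurs twice, once for each direction of `uv`.
  #Tri-triAtPair : ∀ {u v} → Adj G u v → #Tri G All? ≡ #Tri G (Alive? (edge u v)) + 6 * triAtPair G u v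
  #Tri-triAtPair {u} {v} uv = begin
    #Tri G All?
      ≡⟨ #Tri-thrice opposite? exclusive All? (Alive? (edge u v)) (λ _ _ → tt) (λ t _ → mk⇔ (tt ,_) proj₂) ⟩
    #Tri G (Alive? (edge u v)) + 3 * #Tri G (All? ∩? opposite?)
      ≡⟨ cong (λ c → #Tri G (Alive? (edge u v)) + 3 * c) (count-+ Ts _ (finFinite (n G)) (finFinite (n G)) apex? apex?
           (λ w → w , u , v) (λ w → w , v , u) (λ { refl → refl }) (λ { refl → refl })
           (λ w (uw , vw) → (Adj-sym G uw , uv , vw) , tt , inj₁ (refl , refl))
           (λ w (uw , vw) → (Adj-sym G vw , Adj-sym G uv , uw) , tt , inj₂ (refl , refl))
           (λ { _ _ _ _ refl → Adj-irrefl G uv refl })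
           (λ { (w , _ , _) ((wu , _ , vw) , _ , inj₁ (refl , refl)) → inj₁ (w , (Adj-sym G wu , vw) , refl)
              ; (w , _ , _) ((wv , _ , uw) , _ , inj₂ (refl , refl)) → inj₂ (w , (uw , Adj-sym G wv) , refl) })) ⟩
    #Tri G (Alive? (edge u v)) + 3 * (count (finFinite (n G)) apex? + count (finFinite (n G)) apex?)
      ≡⟨ cong (#Tri G (Alive? (edge u v)) +_) (thrice-twice (count (finFinite (n G)) apex?)) ⟩
    #Tri G (Alive? (edge u v)) + 6 * count (finFinite (n G)) apex?
      ≡⟨ cong (λ c → #Tri G (Alive? (edge u v)) + 6 * c)
           (count≡sum (finFinite (n G)) apex? (λ w → adj G u w ∧ adj G v w) (λ w → ∧⇔ ≡⇔ ≡⇔)) ⟩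
    #Tri G (Alive? (edge u v)) + 6 * triAtPair G u v ∎
    where
    open ≡.≡-Reasoning
    Opposite : Triple (n G) → Set
    Opposite (i , j , k) = PairEq j k u v
    opposite? : Decidable Opposite
    opposite? (i , j , k) = PairEq? j k u v
    apex? : Decidable (λ w → Adj G u w × Adj G v w)
    apex? w = Adj? G u w ×-dec Adj? G v w
    exclusive : ∀ t → Tri G t → Opposite t → ¬ Opposite (rotate t)
    exclusive _ (ij , jk , ki) (inj₁ (refl , refl)) (inj₁ (refl , refl)) = Adj-irrefl G jk refl
    exclusive _ (ij , jk , ki) (inj₁ (refl , refl)) (inj₂ (_ , refl))    = Adj-irrefl G ij refl
    exclusive _ (ij , jk , ki) (inj₂ (refl , refl)) (inj₁ (_ , refl))    = Adj-irrefl G ij refl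
    exclusive _ (ij , jk , ki) (inj₂ (refl , refl)) (inj₂ (refl , refl)) = Adj-irrefl G jk refl

  Within : (V G → Bool) → Triple (n G) → Set
  Within S (i , j , k) = S i ≡ true × S j ≡ true × S k ≡ true

  Within? : ∀ S → Decidable (Within S)
  Within? S (i , j , k) = S i Bool.≟ true ×-dec S j Bool.≟ true ×-dec S k Bool.≟ true

  -- The mark is that the least vertex comes first. Every triangle has a rotation of this kind, so
  -- the unmarked class is empty.
  #Tri-triCountIn : ∀ S → #Tri G (Within? S) ≡ 6 * triCountIn G S
  #Tri-triCountIn S = begin
    #Tri G (Within? S)
      ≡⟨ #Tri-thrice least? (λ { _ _ (i<j , _) (_ , j<i) → Fin.<-asym i<j j<i }) (Within? S) none?
           (λ { _ (a , b , c) → b , c , a })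
           (λ { t tri → mk⇔ (λ ()) (λ (_ , p , q , r) → some-least t tri p q r) }) ⟩
    #Tri G none? + 3 * #Tri G (Within? S ∩? least?)
      ≡⟨ cong₂ (λ c d → c + 3 * d) (count-empty Ts (λ t → Tri? G t ×-dec none? t) (λ _ ())) sorted ⟩
    3 * (count Ts sorted? + count Ts sorted?)
      ≡⟨ thrice-twice (count Ts sorted?) ⟩
    6 * count Ts sorted?
      ≡⟨ cong (6 *_) (triCountIn≡count S sorted? (λ i j k → ∧⇔ (lt⇔< {i = i} {j}) (∧⇔ (lt⇔< {i = j} {k})
           (∧⇔ ≡⇔ (∧⇔ ≡⇔ (∧⇔ ≡⇔ (∧⇔ ≡⇔ (∧⇔ ≡⇔ ≡⇔)))))))) ⟩
    6 * triCountIn G S ∎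
    where
    open ≡.≡-Reasoning
    none? : Decidable {A = Triple (n G)} (λ _ → ⊥)
    none? _ = no id
    Least : Triple (n G) → Set
    Least (i , j , k) = i < j × i < k
    least? : Decidable Least
    least? (i , j , k) = i <? j ×-dec i <? k
    Sorted : Triple (n G) → Set
    Sorted (i , j , k) = i < j × j < k × S i ≡ true × S j ≡ true × S k ≡ true × Adj G i j × Adj G j k × Adj G i k
    sorted? : Decidable Sorted
    sorted? (i , j , k) = i <? j ×-dec j <? k ×-dec S i Bool.≟ true ×-dec S j Bool.≟ true ×-dec S k Bool.≟ true
      ×-dec Adj? G i j ×-dec Adj? G j k ×-dec Adj? G i k
    some-least : ∀ t → Tri G t → ¬ Least t → ¬ Least (rotate t) → ¬ Least (rotate (rotate t)) → ⊥
    some-least (i , j , k) (ij , jk , ki) p q r with Fin.<-cmp i j | Fin.<-cmp j k | Fin.<-cmp k i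
    ... | tri≈ _ e _   | _            | _            = Adj-irrefl G ij e
    ... | _            | tri≈ _ e _   | _            = Adj-irrefl G jk e
    ... | _            | _            | tri≈ _ e _   = Adj-irrefl G ki e
    ... | tri< i<j _ _ | _            | tri> _ _ i<k = p (i<j , i<k)
    ... | tri> _ _ j<i | tri< j<k _ _ | _            = q (j<k , j<i)
    ... | _            | tri> _ _ k<j | tri< k<i _ _ = r (k<i , k<j)
    ... | tri< i<j _ _ | tri< j<k _ _ | tri< k<i _ _ = Fin.<-asym (Fin.<-trans i<j j<k) k<i
    ... | tri> _ _ j<i | tri> _ _ k<j | tri> _ _ i<k = Fin.<-asym (Fin.<-trans i<k k<j) j<i
    swap₂₃ : Triple (n G) → Triple (n G)
    swap₂₃ (i , j , k) = i , k , j
    sorted : #Tri G (Within? S ∩? least?) ≡ count Ts sorted? + count Ts sorted?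
    sorted = count-+ Ts _ Ts Ts sorted? sorted? id swap₂₃ id (λ { refl → refl })
      (λ { t (i<j , j<k , si , sj , sk , ij , jk , ik) →
           (ij , jk , Adj-sym G ik) , (si , sj , sk) , i<j , Fin.<-trans i<j j<k })
      (λ { t (i<j , j<k , si , sj , sk , ij , jk , ik) →
           (ik , Adj-sym G jk , Adj-sym G ij) , (si , sk , sj) , Fin.<-trans i<j j<k , i<j })
      (λ { _ _ (_ , j<k , _) (_ , k<j , _) refl → Fin.<-asym j<k k<j })
      cover
      where
      cover : ∀ t → Tri G t × Within S t × Least t →
        (∃ λ s → Sorted s × s ≡ t) ⊎ (∃ λ s → Sorted s × swap₂₃ s ≡ t)
      cover (i , j , k) ((ij , jk , ki) , (si , sj , sk) , i<j , i<k) with Fin.<-cmp j k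
      ... | tri< j<k _ _ = inj₁ (_ , (i<j , j<k , si , sj , sk , ij , jk , Adj-sym G ki) , refl)
      ... | tri≈ _ e _   = ⊥-elim (Adj-irrefl G jk e)
      ... | tri> _ _ k<j = inj₂ (_ , (i<k , k<j , si , sk , sj , Adj-sym G ki , Adj-sym G jk , ij) , refl)

  #Tri-triCount : #Tri G All? ≡ 6 * triCount G
  #Tri-triCount = ≡.trans
    (#Tri-cong G All? (Within? (λ _ → true)) (λ _ _ _ → refl , refl , refl) (λ _ _ _ → tt))
    (#Tri-triCountIn (λ _ → true))

-- The base case: damages of the complete graph on four vertices, by exhaustion

K₄ : Graph
K₄ = record
  { n   = 4
  ; adj = λ i j → not (does (i ≟ j))
  ; sym = from-yes (all? {n = 4} λ i → all? {n = 4} λ j → not (does (i ≟ j)) Bool.≟ not (does (j ≟ i)))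
  ; irr = from-yes (all? {n = 4} λ i → not (does (i ≟ i)) Bool.≟ false)
  }

Proper? : (G : Graph) → Decidable (Proper G)
Proper? G (edge u v)  = Adj? G u v
Proper? G (split z s) =
  any? (λ a → Adj? G z a ×-dec (s a Bool.≟ true)) ×-dec any? (λ a → Adj? G z a ×-dec (s a Bool.≟ false))

K₄-edge : ∀ u v → Adj K₄ u v → #Tri K₄ (Alive? (edge u v)) ≡ 12
K₄-edge = from-yes (all? λ u → all? λ v → Adj? K₄ u v →-dec (#Tri K₄ (Alive? (edge u v)) ℕ.≟ 12))

-- The halves are given by a vector so that `anySubset?` can search them all. The search is for a
-- counterexample, and decidability of equality turns its failure into the claim.
K₄-split : ∀ z w → Proper K₄ (split z (lookup w)) → #Tri K₄ (Alive? (split z (lookup w))) ≡ 12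
K₄-split z w proper = decidable-stable (_ ℕ.≟ _) λ ≢12 →
  from-no (any? λ z → anySubset? λ w →
    Proper? K₄ (split z (lookup w)) ×-dec ¬? (#Tri K₄ (Alive? (split z (lookup w))) ℕ.≟ 12))
  (z , w , proper , ≢12)

K₄-avoid : ∀ v → #Tri K₄ (Avoids? v) ≡ 6
K₄-avoid = from-yes (all? λ v → #Tri K₄ (Avoids? v) ℕ.≟ 6)

-- A side function agrees pointwise with the lookup in its own table, and both survival and
-- properness read it only pointwise.
K₄-damage : ∀ d → Proper K₄ d → #Tri K₄ (Alive? d) ≡ 12
K₄-damage (edge u v)  proper = K₄-edge u v proper
K₄-damage (split z s) ((a , za , sa) , (b , zb , sb)) =
  ≡.trans
    (#Tri-cong K₄ (Alive? (split z s)) (Alive? (split z s′))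
      (λ { _ _ (p , q , r) → to′ ∘ p , to′ ∘ q , to′ ∘ r })
      (λ { _ _ (p , q , r) → from′ ∘ p , from′ ∘ q , from′ ∘ r }))
    (K₄-split z (tabulate s) ((a , za , ≡.trans (s′≗s a) sa) , (b , zb , ≡.trans (s′≗s b) sb)))
  where
  s′ = lookup (tabulate s)
  s′≗s : ∀ i → s′ i ≡ s i
  s′≗s = lookup∘tabulate s
  to′ : ∀ {i j} → s i ≡ s j → s′ i ≡ s′ j
  to′ {i} {j} e = ≡.trans (s′≗s i) (≡.trans e (≡.sym (s′≗s j)))
  from′ : ∀ {i j} → s′ i ≡ s′ j → s i ≡ s j
  from′ {i} {j} e = ≡.trans (≡.sym (s′≗s i)) (≡.trans e (s′≗s j))

IsK4⇒adj : (G : Graph) (k : IsK4 G) → ∀ i j → adj G i j ≡ not (does (i ≟ j))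
IsK4⇒adj G (_ , k) i j with i ≟ j
... | yes refl = irr G i
... | no i≢j   = from (k i j) i≢j

-- A complete graph on `Fin 4` has the very adjacency of `K₄`, so the counts are compared triple by
-- triple, with no relabelling of vertices.
#Tri-IsK4 : (G : Graph) (4≡ : n G ≡ 4) → (∀ i j → adj G i j ≡ not (does (i ≟ j))) →
  (∀ d → Proper G d → #Tri G (Alive? d) ≡ 12) × (∀ v → #Tri G (Avoids? v) ≡ 6) × #Tri G All? ≡ 24
#Tri-IsK4 record { n = .4 ; adj = A ; sym = A-sym ; irr = A-irr } refl A≗ =
  (λ d proper → ≡.trans (same (Alive? d)) (K₄-damage d (proper′ d proper))) ,
  (λ v → ≡.trans (same (Avoids? v)) (K₄-avoid v)) ,
  same All?
  where
  G : Graph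
  G = record { n = 4 ; adj = A ; sym = A-sym ; irr = A-irr }
  same : ∀ {α} (α? : Decidable α) → #Tri G α? ≡ #Tri K₄ α?
  same α? = ℕ.≤-antisym
    (count-mono (triples 4) P? Q? (λ { (i , j , k) ((ij , jk , ki) , a) → (out ij , out jk , out ki) , a }))
    (count-mono (triples 4) Q? P? (λ { (i , j , k) ((ij , jk , ki) , a) → (into ij , into jk , into ki) , a }))
    where
    P? = λ t → Tri? G t ×-dec α? t
    Q? = λ t → Tri? K₄ t ×-dec α? t
    into : ∀ {i j} → Adj K₄ i j → Adj G i j
    into = ≡.trans (A≗ _ _)
    out : ∀ {i j} → Adj G i j → Adj K₄ i j
    out = ≡.trans (≡.sym (A≗ _ _))
  proper′ : ∀ d → Proper G d → Proper K₄ d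
  proper′ (edge u v)  uv = ≡.trans (≡.sym (A≗ u v)) uv
  proper′ (split z s) ((a , za , sa) , (b , zb , sb)) =
    (a , ≡.trans (≡.sym (A≗ z a)) za , sa) , (b , ≡.trans (≡.sym (A≗ z b)) zb , sb)

-- The damages of a composition

PairEq-map : ∀ {m m′} {h : Fin m → Fin m′} {a b u v} → PairEq a b u v → PairEq (h a) (h b) (h u) (h v)
PairEq-map {h = h} (inj₁ (p , q)) = inj₁ (cong h p , cong h q)
PairEq-map {h = h} (inj₂ (p , q)) = inj₂ (cong h p , cong h q)

module _ {G₁ G₂ H : Graph} (Γ : Gluing G₁ G₂ H) where
  open Gluing Γ

  PairEq-f : ∀ {a b u v} → PairEq (f a) (f b) (f u) (f v) → PairEq a b u v
  PairEq-f (inj₁ (p , q)) = inj₁ (f-inj _ _ p , f-inj _ _ q)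
  PairEq-f (inj₂ (p , q)) = inj₂ (f-inj _ _ p , f-inj _ _ q)

  PairEq-lift : ∀ {a b c d p q} → PairEq (lift a c) (lift b d) p q → PairEq a b (π p) (π q)
  PairEq-lift {a} {b} {c} {d} {p} {q} e =
    ≡.subst₂ (λ a b → PairEq a b (π p) (π q)) (π-lift a c) (π-lift b d) (PairEq-map {h = π} e)

  -- Only implications towards survival in `H` are recorded: all later estimates bound counts in `H`
  -- from below or compare one surviving set with a smaller one. In `shared`, the split vertex
  -- belongs to both parts.
  data Located (d : Damage) : Set where
    in₁    : ∀ d₁ → Proper G₁ d₁ →
             (∀ t → Alive d₁ t → Alive d (mapT f t)) →
             (∀ t → Tri G₂ t → Alive damage₂ t → Alive d (liftT t)) → Located d
    in₂    : ∀ d₂ → Proper G₂ d₂ →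
             (∀ t → Alive d (mapT f t)) →
             (∀ t → Tri G₂ t → Alive damage₂ t → Alive d₂ t → Alive d (liftT t)) → Located d
    shared : ∀ u → u ≡ x ⊎ u ≡ y →
             (∀ t → Avoids u t → Alive d (mapT f t)) →
             (∀ t → Avoids z t → Alive d (liftT t)) → Located d

  mapT-alive : ∀ {d d₁} → (∀ t → Corner d₁ t → Corner d (mapT f t)) →
    ∀ t → Alive d₁ t → Alive d (mapT f t)
  mapT-alive corner t (κ , κ′ , κ″) = corner t κ , corner _ κ′ , corner _ κ″

  mapT-all-alive : ∀ {d} → (∀ t → Corner d (mapT f t)) → ∀ t → Alive d (mapT f t)
  mapT-all-alive corner t = corner t , corner _ , corner _

  liftT-all-alive : ∀ {d} → (∀ t → Tri G₂ t → Corner d (liftT t)) → ∀ t → Tri G₂ t → Alive d (liftT t)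
  liftT-all-alive corner t tri =
    corner t tri , corner _ (Tri-rotate G₂ t tri) , corner _ (Tri-rotate G₂ _ (Tri-rotate G₂ t tri))

  liftT-alive : ∀ {d d₂} →
    (∀ t → Alive damage₂ t → Corner d₂ t → Corner d (liftT t)) →
    ∀ t → Alive damage₂ t → Alive d₂ t → Alive d (liftT t)
  liftT-alive corner t al (κ , κ′ , κ″) =
    corner t al κ ,
    corner _ (Alive-rotate damage₂ t al) κ′ ,
    corner _ (Alive-rotate damage₂ _ (Alive-rotate damage₂ t al)) κ″

  -- A lifted triangle has at most one vertex in the copy of `G₁`, so the deletion of an edge of
  -- this copy spares it.
  edge-in₁ : ∀ {u v} → Adj H (f u) (f v) → Located (edge (f u) (f v))
  edge-in₁ {u} {v} uv = in₁ (edge u v) (proj₁ (to (adj-ff u v) uv))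
    (mapT-alive {edge (f u) (f v)} {edge u v} λ t κ e → κ (PairEq-f e))
    (λ t tri _ → liftT-all-alive {edge (f u) (f v)}
      (λ { (c , a , b) (_ , ab , _) (inj₁ (p , q)) → lift-not-ff {a} {b} ab p q
         ; (c , a , b) (_ , ab , _) (inj₂ (p , q)) → lift-not-ff {a} {b} ab p q }) t tri)

  -- The deleted edge is the image under `π`. It does not join two vertices of the copy of `G₁`, so
  -- no triangle of that copy is lost.
  edge-in₂ : ∀ {p q} → Adj G₂ (π p) (π q) → (∀ a b → ¬ PairEq (f a) (f b) p q) → Located (edge p q)
  edge-in₂ {p} {q} pq not-ff = in₂ (edge (π p) (π q)) pq
    (mapT-all-alive {edge p q} λ (c , a , b) → not-ff a b)
    (λ t _ → liftT-alive {edge p q} {edge (π p) (π q)} (λ (c , a , b) _ κ e → κ (PairEq-lift e)) t)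

  -- The neighbours of an identified vertex come from both parts, and the halves restricted to one
  -- part may be empty. What certainly survives is what avoids the vertex, which is why avoidance
  -- enters the induction.
  split-shared : ∀ {u} s → u ≡ x ⊎ u ≡ y → Located (split (f u) s)
  split-shared {u} s end = shared u end
    (λ t (i≢u , j≢u , k≢u) → ⊥-elim ∘ i≢u ∘ f-inj _ _ , ⊥-elim ∘ j≢u ∘ f-inj _ _ , ⊥-elim ∘ k≢u ∘ f-inj _ _)
    (λ (a , b , c) (a≢z , b≢z , c≢z) →
      ⊥-elim ∘ a≢z ∘ lift≡f⇒z {a} {b} , ⊥-elim ∘ b≢z ∘ lift≡f⇒z {b} {c} , ⊥-elim ∘ c≢z ∘ lift≡f⇒z {c} {a})

  -- Away from the two ends, all neighbours of `f u` lie in the copy of `G₁`, so both halves stay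
  -- nonempty there.
  split-in₁ : ∀ {u} s → ¬ (u ≡ x ⊎ u ≡ y) → Proper H (split (f u) s) → Located (split (f u) s)
  split-in₁ {u} s not-end ((p , up , sp) , (q , uq , sq)) =
    in₁ (split u (s ∘ f)) (neighbour up sp , neighbour uq sq)
      (mapT-alive {split (f u) s} {split u (s ∘ f)} λ t κ → κ ∘ f-inj _ _)
      (λ t tri _ → liftT-all-alive {split (f u) s}
        (λ { (a , b , c) _ e → ⊥-elim (not-end (lift≡f⇒end {a} {b} e)) }) t tri)
    where
    neighbour : ∀ {p β} → Adj H (f u) p → s p ≡ β → ∃ λ v → Adj G₁ u v × s (f v) ≡ β
    neighbour {p} up sp with cover p
    ... | inj₁ (v , refl)       = v , proj₁ (to (adj-ff u v) up) , sp
    ... | inj₂ (a , a≢z , refl) = ⊥-elim (not-end (end (side a) (proj₂ (fg-split-end a≢z up))))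
      where
      end : ∀ b → u ≡ split-end b → u ≡ x ⊎ u ≡ y
      end true  = inj₁
      end false = inj₂

  -- A neighbour `b` of `a` is put in the half of its lift seen from `a`; for `b` equal to `z` this
  -- is the end to which `a` is attached.
  split-in₂ : ∀ {a} s → a ≢ z → Proper H (split (g a) s) → Located (split (g a) s)
  split-in₂ {a} s a≢z ((p , ap , sp) , (q , aq , sq)) =
    in₂ (split a s′) (neighbour ap sp , neighbour aq sq)
      (mapT-all-alive {split (g a) s} λ (c , _ , _) e → ⊥-elim (fg-disj c a a≢z e))
      (λ t _ → liftT-alive {split (g a) s} {split a s′} corner t)
    where
    s′ : V G₂ → Bool
    s′ b = s (lift b a)
    neighbour : ∀ {p β} → Adj H (g a) p → s p ≡ β → ∃ λ b → Adj G₂ a b × s′ b ≡ β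
    neighbour {p} ap sp with cover p
    ... | inj₁ (u , refl) with fg-split-end a≢z (Adj-sym H ap)
    ...   | za , refl = z , Adj-sym G₂ za , ≡.trans (cong s (lift-z a)) sp
    neighbour {p} ap sp | inj₂ (b , b≢z , refl) =
      b , ≡.trans (≡.sym (adj-gg a b a≢z b≢z)) ap , ≡.trans (cong s (lift-g a b≢z)) sp
    corner : ∀ t → Alive damage₂ t → Corner (split a s′) t → Corner (split (g a) s) (liftT t)
    -- Applying `π` to `e` identifies `c` with `a`. Survival of `damage₂` at `b` then turns
    -- `lift b b′` into `lift b a`, the vertex that `s′` reads.
    corner (c , b , b′) (_ , κ , _) κ′ e
      with refl ← ≡.trans (≡.sym (π-lift c b)) (≡.trans (cong π e) (π-g a≢z)) =
      ≡.trans (cong s (lift-corner κ)) (κ′ refl)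

  locate : ∀ d → Proper H d → Located d
  locate (edge p q) pq with cover p | cover q
  ... | inj₁ (u , refl) | inj₁ (v , refl) = edge-in₁ pq
  ... | inj₁ (u , refl) | inj₂ (a , a≢z , refl) =
    edge-in₂ (≡.subst₂ (Adj G₂) (≡.sym (π-f u)) (≡.sym (π-g a≢z)) (proj₁ (fg-split-end a≢z pq)))
      λ { b c (inj₁ (_ , e)) → fg-disj c a a≢z e ; b c (inj₂ (e , _)) → fg-disj b a a≢z e }
  ... | inj₂ (a , a≢z , refl) | inj₁ (u , refl) =
    edge-in₂ (≡.subst₂ (Adj G₂) (≡.sym (π-g a≢z)) (≡.sym (π-f u))
        (Adj-sym G₂ (proj₁ (fg-split-end a≢z (Adj-sym H pq)))))
      λ { b c (inj₁ (e , _)) → fg-disj b a a≢z e ; b c (inj₂ (_ , e)) → fg-disj c a a≢z e }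
  ... | inj₂ (a , a≢z , refl) | inj₂ (b , b≢z , refl) =
    edge-in₂ (≡.subst₂ (Adj G₂) (≡.sym (π-g a≢z)) (≡.sym (π-g b≢z))
        (≡.trans (≡.sym (adj-gg a b a≢z b≢z)) pq))
      λ { c d (inj₁ (e , _)) → fg-disj c a a≢z e ; c d (inj₂ (_ , e)) → fg-disj d a a≢z e }
  locate (split p s) proper with cover p
  ... | inj₂ (a , a≢z , refl) = split-in₂ s a≢z proper
  ... | inj₁ (u , refl) with u ≟ x | u ≟ y
  ...   | yes u≡x | _       = split-shared s (inj₁ u≡x)
  ...   | no _    | yes u≡y = split-shared s (inj₂ u≡y)
  ...   | no u≢x  | no u≢y  = split-in₁ s [ u≢x , u≢y ]′ proper

  module _ {α : Triple (n H) → Set} (α? : Decidable α) where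

    #₁ #₂ : ℕ
    #₁ = #Tri G₁ (Alive? damage₁ ∩? (α? ∘ mapT f))
    #₂ = #Tri G₂ (Alive? damage₂ ∩? (α? ∘ liftT))

    #₁-intact : (∀ t → α (mapT f t)) → #Tri G₁ (Alive? damage₁) ≤ #₁
    #₁-intact all = #Tri-mono G₁ (Alive? damage₁) _ λ t _ al → al , all t

    #₂-intact : (∀ t → Tri G₂ t → Alive damage₂ t → α (liftT t)) → #Tri G₂ (Alive? damage₂) ≤ #₂
    #₂-intact all = #Tri-mono G₂ (Alive? damage₂) _ λ t tri al → al , all t tri al

    -- A triangle missing one end of the deleted edge does not contain that edge, so `damage₁`
    -- spares it.
    #₁-avoid : ∀ u → u ≡ x ⊎ u ≡ y → (∀ t → Avoids u t → α (mapT f t)) → #Tri G₁ (Avoids? u) ≤ #₁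
    #₁-avoid u end all = #Tri-mono G₁ (Avoids? u) _ λ t _ av → alive end t av , all t av
      where
      alive : ∀ {u} → u ≡ x ⊎ u ≡ y → ∀ t → Avoids u t → Alive damage₁ t
      alive (inj₁ refl) t (i , j , k) =
        [ j ∘ proj₁ , k ∘ proj₂ ]′ , [ k ∘ proj₁ , i ∘ proj₂ ]′ , [ i ∘ proj₁ , j ∘ proj₂ ]′
      alive (inj₂ refl) t (i , j , k) =
        [ k ∘ proj₂ , j ∘ proj₁ ]′ , [ i ∘ proj₂ , k ∘ proj₁ ]′ , [ j ∘ proj₂ , i ∘ proj₁ ]′

    #₂-avoid : (∀ t → Tri G₂ t → Alive damage₂ t → Avoids z t → α (liftT t)) → #Tri G₂ (Avoids? z) ≤ #₂
    #₂-avoid all = #Tri-mono G₂ (Avoids? z) _ λ t tri av → let al = avoid-alive t av in al , all t tri al av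
      where
      avoid-alive : ∀ t → Avoids z t → Alive damage₂ t
      avoid-alive t (i , j , k) = ⊥-elim ∘ i , ⊥-elim ∘ j , ⊥-elim ∘ k

  #₁-All : #₁ All? ≡ #Tri G₁ (Alive? damage₁)
  #₁-All = #Tri-cong G₁ _ _ (λ _ _ → proj₁) (λ _ _ al → al , tt)

  #₂-All : #₂ All? ≡ #Tri G₂ (Alive? damage₂)
  #₂-All = #Tri-cong G₂ _ _ (λ _ _ → proj₁) (λ _ _ al → al , tt)

-- The induction hypothesis; the counts are six times the numbers of triangles.
record TriangleBounds (G : Graph) : Set where
  field
    total         : 24 ≤ #Tri G All?
    avoiding      : ∀ v → 6 ≤ #Tri G (Avoids? v)
    avoiding′     : IsK4 G ⊎ (∀ v → 12 ≤ #Tri G (Avoids? v))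
    damaged       : ∀ d → Proper G d → 12 ≤ #Tri G (Alive? d)
    damaged-tight : ∀ d → Proper G d → #Tri G (Alive? d) ≡ 12 → #Tri G All? ≡ 24
    damaged-twice : ∀ d d′ → Proper G d → Proper G d′ →
                    #Tri G (Alive? d ∩? Alive? d′) ≡ 0 → #Tri G (Alive? d) ≡ 12

#Tri-K4 : (G : Graph) → IsK4 G →
  (∀ d → Proper G d → #Tri G (Alive? d) ≡ 12) × (∀ v → #Tri G (Avoids? v) ≡ 6) × #Tri G All? ≡ 24
#Tri-K4 G k = #Tri-IsK4 G (proj₁ k) (IsK4⇒adj G k)

bounds-K4 : (G : Graph) → IsK4 G → TriangleBounds G
bounds-K4 G k = record
  { total         = ℕ.≤-reflexive (≡.sym total≡24)
  ; avoiding      = λ v → ℕ.≤-reflexive (≡.sym (avoiding≡6 v))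
  ; avoiding′     = inj₁ k
  ; damaged       = λ d proper → ℕ.≤-reflexive (≡.sym (damaged≡12 d proper))
  ; damaged-tight = λ _ _ _ → total≡24
  ; damaged-twice = λ d _ proper _ _ → damaged≡12 d proper
  }
  where
  damaged≡12 = proj₁ (#Tri-K4 G k)
  avoiding≡6 = proj₁ (proj₂ (#Tri-K4 G k))
  total≡24 = proj₂ (proj₂ (#Tri-K4 G k))

≤-sum-tightˡ : ∀ {k l a b} → k ≤ a → l ≤ b → a + b ≡ k + l → a ≡ k
≤-sum-tightˡ {k} {l} {a} {b} k≤a l≤b e = ℕ.≤-antisym
  (ℕ.+-cancelʳ-≤ l a k (ℕ.≤-trans (ℕ.+-monoʳ-≤ a l≤b) (ℕ.≤-reflexive e))) k≤a

≤-sum-tightʳ : ∀ {k l a b} → k ≤ a → l ≤ b → a + b ≡ k + l → b ≡ l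
≤-sum-tightʳ {k} {l} {a} {b} k≤a l≤b e =
  ≤-sum-tightˡ l≤b k≤a (≡.trans (ℕ.+-comm b a) (≡.trans e (ℕ.+-comm k l)))

-- The inductive step

module _ {G₁ G₂ H : Graph} (Γ : Gluing G₁ G₂ H)
         (proper₁ : Proper G₁ (Gluing.damage₁ Γ)) (proper₂ : Proper G₂ (Gluing.damage₂ Γ))
         (B₁ : TriangleBounds G₁) (B₂ : TriangleBounds G₂) where
  open Gluing Γ
  module B₁ = TriangleBounds B₁
  module B₂ = TriangleBounds B₂

  ≥12₁ : 12 ≤ #Tri G₁ (Alive? damage₁)
  ≥12₁ = B₁.damaged damage₁ proper₁

  ≥12₂ : 12 ≤ #Tri G₂ (Alive? damage₂)
  ≥12₂ = B₂.damaged damage₂ proper₂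

  step-≥ : ∀ {α} (α? : Decidable α) {k l} → k ≤ #₁ Γ α? → l ≤ #₂ Γ α? → k + l ≤ #Tri H α?
  step-≥ α? p q = ℕ.≤-trans (ℕ.+-mono-≤ p q) (ℕ.≤-reflexive (≡.sym (#Tri-H α?)))

  step-≡ : ∀ {α} (α? : Decidable α) {k l} → #₁ Γ α? ≡ k → #₂ Γ α? ≡ l → #Tri H α? ≡ k + l
  step-≡ α? p q = ≡.trans (#Tri-H α?) (cong₂ _+_ p q)

  step-total≡24 : #Tri G₁ (Alive? damage₁) ≡ 12 → #Tri G₂ (Alive? damage₂) ≡ 12 → #Tri H All? ≡ 24
  step-total≡24 p q = step-≡ All? (≡.trans (#₁-All Γ) p) (≡.trans (#₂-All Γ) q)

  step-total : 24 ≤ #Tri H All?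
  step-total = step-≥ All? (ℕ.≤-trans ≥12₁ (ℕ.≤-reflexive (≡.sym (#₁-All Γ))))
                           (ℕ.≤-trans ≥12₂ (ℕ.≤-reflexive (≡.sym (#₂-All Γ))))

  -- An identified vertex belongs to both parts, and each part supplies one triangle that misses it:
  -- 6 + 6.
  step-avoiding-end : ∀ u → u ≡ x ⊎ u ≡ y → 12 ≤ #Tri H (Avoids? (f u))
  step-avoiding-end u end = step-≥ (Avoids? (f u))
    (ℕ.≤-trans (B₁.avoiding u) (#₁-avoid Γ (Avoids? (f u)) u end
      λ t (i , j , k) → i ∘ f-inj _ _ , j ∘ f-inj _ _ , k ∘ f-inj _ _))
    (ℕ.≤-trans (B₂.avoiding z) (#₂-avoid Γ (Avoids? (f u))
      λ (a , b , c) _ _ (i , j , k) → i ∘ lift≡f⇒z {a} {b} , j ∘ lift≡f⇒z {b} {c} , k ∘ lift≡f⇒z {c} {a}))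

  -- For a vertex interior to one part, the two triangles surviving in the other part all miss it.
  step-avoiding : ∀ v → 12 ≤ #Tri H (Avoids? v)
  step-avoiding v with cover v
  ... | inj₂ (a , a≢z , refl) = ℕ.≤-trans (ℕ.m≤m+n 12 0) (step-≥ (Avoids? (g a))
    (ℕ.≤-trans ≥12₁ (#₁-intact Γ (Avoids? (g a))
      λ (i , j , k) → fg-disj i a a≢z , fg-disj j a a≢z , fg-disj k a a≢z)) z≤n)
  ... | inj₁ (u , refl) with u ≟ x | u ≟ y
  ...   | yes u≡x | _       = step-avoiding-end u (inj₁ u≡x)
  ...   | no _    | yes u≡y = step-avoiding-end u (inj₂ u≡y)
  ...   | no u≢x  | no u≢y  = step-≥ (Avoids? (f u)) {0} z≤n
    (ℕ.≤-trans ≥12₂ (#₂-intact Γ (Avoids? (f u)) λ (a , b , c) _ _ → ne a b , ne b c , ne c a))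
    where
    ne : ∀ a b → lift a b ≢ f u
    ne a b e = [ u≢x , u≢y ]′ (lift≡f⇒end {a} {b} e)

  -- A part untouched by `d` supplies two survivors alone; for a split at an identified vertex, each
  -- part supplies one triangle avoiding it.
  step-damaged : ∀ d → Proper H d → 12 ≤ #Tri H (Alive? d)
  step-damaged d proper with locate Γ d proper
  ... | in₁ _ _ _ all = step-≥ (Alive? d) {0} z≤n (ℕ.≤-trans ≥12₂ (#₂-intact Γ (Alive? d) all))
  ... | in₂ _ _ all _ = step-≥ (Alive? d) {12} {0} (ℕ.≤-trans ≥12₁ (#₁-intact Γ (Alive? d) all)) z≤n
  ... | shared u end av₁ av₂ = step-≥ (Alive? d)
    (ℕ.≤-trans (B₁.avoiding u) (#₁-avoid Γ (Alive? d) u end av₁))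
    (ℕ.≤-trans (B₂.avoiding z) (#₂-avoid Γ (Alive? d) λ t _ _ → av₂ t))

  -- The composition's own damage is the first of the two damages in `damaged-twice`, so that part
  -- is tight under it.
  #₁-none : ∀ d₁ → Proper G₁ d₁ → {α : Triple (n H) → Set} (α? : Decidable α) →
    (∀ t → Alive d₁ t → α (mapT f t)) → #₁ Γ α? ≡ 0 → #Tri G₁ (Alive? damage₁) ≡ 12
  #₁-none d₁ p α? all none = B₁.damaged-twice damage₁ d₁ proper₁ p (ℕ.n≤0⇒n≡0 (ℕ.≤-trans
    (#Tri-mono G₁ (Alive? damage₁ ∩? Alive? d₁) _ λ t _ (al , al′) → al , all t al′)
    (ℕ.≤-reflexive none)))

  #₂-none : ∀ d₂ → Proper G₂ d₂ → {α : Triple (n H) → Set} (α? : Decidable α) →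
    (∀ t → Tri G₂ t → Alive damage₂ t → Alive d₂ t → α (liftT t)) → #₂ Γ α? ≡ 0 →
    #Tri G₂ (Alive? damage₂) ≡ 12
  #₂-none d₂ p α? all none = B₂.damaged-twice damage₂ d₂ proper₂ p (ℕ.n≤0⇒n≡0 (ℕ.≤-trans
    (#Tri-mono G₂ (Alive? damage₂ ∩? Alive? d₂) _ λ t tri (al , al′) → al , all t tri al al′)
    (ℕ.≤-reflexive none)))

  -- Outside `K₄` two triangles avoid `v`; in `K₄` every proper damage leaves exactly two.
  tight-avoiding⇒damaged : (G : Graph) (B : TriangleBounds G) → ∀ v → #Tri G (Avoids? v) ≤ 6 →
    ∀ d → Proper G d → #Tri G (Alive? d) ≡ 12
  tight-avoiding⇒damaged G B v ≤6 with TriangleBounds.avoiding′ B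
  ... | inj₁ k   = proj₁ (#Tri-K4 G k)
  ... | inj₂ ≥12 = ⊥-elim (ℕ.<⇒≱ (ℕ.m≤m+n 7 5) (ℕ.≤-trans (≥12 v) ≤6))

  -- The untouched part already accounts for all 12, so in the other part nothing survives both `d`
  -- and the damage of the composition, and `damaged-twice` makes it tight. For a shared split each
  -- part contributes exactly 6, which forces both to be `K₄`.
  step-damaged-tight : ∀ d → Proper H d → #Tri H (Alive? d) ≡ 12 → #Tri H All? ≡ 24
  step-damaged-tight d proper ≡12 with locate Γ d proper
  ... | in₁ d₁ p₁ all₁ all₂ = step-total≡24
    (#₁-none d₁ p₁ (Alive? d) all₁ (≤-sum-tightˡ z≤n ≥12 (≡.trans (≡.sym (#Tri-H (Alive? d))) ≡12)))
    (ℕ.≤-antisym (ℕ.≤-trans (#₂-intact Γ (Alive? d) all₂) (ℕ.≤-reflexive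
      (≤-sum-tightʳ z≤n ≥12 (≡.trans (≡.sym (#Tri-H (Alive? d))) ≡12)))) ≥12₂)
    where
    ≥12 = ℕ.≤-trans ≥12₂ (#₂-intact Γ (Alive? d) all₂)
  ... | in₂ d₂ p₂ all₁ all₂ = step-total≡24
    (ℕ.≤-antisym (ℕ.≤-trans (#₁-intact Γ (Alive? d) all₁) (ℕ.≤-reflexive
      (≤-sum-tightˡ ≥12 z≤n (≡.trans (≡.sym (#Tri-H (Alive? d))) ≡12)))) ≥12₁)
    (#₂-none d₂ p₂ (Alive? d) all₂ (≤-sum-tightʳ ≥12 z≤n (≡.trans (≡.sym (#Tri-H (Alive? d))) ≡12)))
    where
    ≥12 = ℕ.≤-trans ≥12₁ (#₁-intact Γ (Alive? d) all₁)
  ... | shared u end av₁ av₂ = step-total≡24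
    (tight-avoiding⇒damaged G₁ B₁ u (ℕ.≤-trans (#₁-avoid Γ (Alive? d) u end av₁)
      (ℕ.≤-reflexive (≤-sum-tightˡ ≥6₁ ≥6₂ split≡12))) damage₁ proper₁)
    (tight-avoiding⇒damaged G₂ B₂ z (ℕ.≤-trans (#₂-avoid Γ (Alive? d) λ t _ _ → av₂ t)
      (ℕ.≤-reflexive (≤-sum-tightʳ ≥6₁ ≥6₂ split≡12))) damage₂ proper₂)
    where
    ≥6₁ = ℕ.≤-trans (B₁.avoiding u) (#₁-avoid Γ (Alive? d) u end av₁)
    ≥6₂ = ℕ.≤-trans (B₂.avoiding z) (#₂-avoid Γ (Alive? d) λ t _ _ → av₂ t)
    split≡12 : #₁ Γ (Alive? d) + #₂ Γ (Alive? d) ≡ 6 + 6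
    split≡12 = ≡.trans (≡.sym (#Tri-H (Alive? d))) ≡12

  -- If both damages lie in one part, the other part has survivors; if one is shared, a triangle
  -- avoiding the split vertex survives. So one damage lies in each part. The part hit by `d` has no
  -- survivor of `d`, since `d′` does not touch it; in the other part at most the survivors of the
  -- composition remain, and these number 12 by `damaged-twice`.
  step-damaged-twice : ∀ d d′ → Proper H d → Proper H d′ →
    #Tri H (Alive? d ∩? Alive? d′) ≡ 0 → #Tri H (Alive? d) ≡ 12
  step-damaged-twice d d′ proper proper′ ≡0 = helper (locate Γ d proper) (locate Γ d′ proper′)
    where
    both? = Alive? d ∩? Alive? d′
    sum≡0 : #₁ Γ both? + #₂ Γ both? ≡ 0
    sum≡0 = ≡.trans (≡.sym (#Tri-H both?)) ≡0
    #₁≡0 : #₁ Γ both? ≡ 0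
    #₁≡0 = ℕ.m+n≡0⇒m≡0 _ sum≡0
    #₂≡0 : #₂ Γ both? ≡ 0
    #₂≡0 = ℕ.m+n≡0⇒n≡0 (#₁ Γ both?) sum≡0
    absurd : ∀ {k l} {A : Set} → ℕ.suc k ≤ l → l ≡ 0 → A
    absurd () refl
    upper : #Tri H (Alive? d) ≤ 12 → #Tri H (Alive? d) ≡ 12
    upper ≤12 = ℕ.≤-antisym ≤12 (step-damaged d proper)
    shared-absurd₁ : ∀ {A : Set} u → u ≡ x ⊎ u ≡ y →
      (∀ t → Avoids u t → Alive d (mapT f t) × Alive d′ (mapT f t)) → A
    shared-absurd₁ u end all = absurd (ℕ.≤-trans (B₁.avoiding u) (#₁-avoid Γ both? u end all)) #₁≡0
    shared-absurd₂ : ∀ {A : Set} →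
      (∀ t → Tri G₂ t → Alive damage₂ t → Avoids z t → Alive d (liftT t) × Alive d′ (liftT t)) → A
    shared-absurd₂ all = absurd (ℕ.≤-trans (B₂.avoiding z) (#₂-avoid Γ both? all)) #₂≡0
    helper : Located Γ d → Located Γ d′ → #Tri H (Alive? d) ≡ 12
    helper (in₁ _ _ _ all) (in₁ _ _ _ all′) = absurd
      (ℕ.≤-trans ≥12₂ (#₂-intact Γ both? λ t tri al → all t tri al , all′ t tri al)) #₂≡0
    helper (in₂ _ _ all _) (in₂ _ _ all′ _) = absurd
      (ℕ.≤-trans ≥12₁ (#₁-intact Γ both? λ t → all t , all′ t)) #₁≡0
    helper (in₁ _ _ _ all₂) (in₂ d₂ p₂ all₁′ all₂′) = upper (ℕ.≤-trans
      (ℕ.≤-reflexive (#Tri-H (Alive? d)))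
      (ℕ.+-mono-≤
        (ℕ.≤-trans (#Tri-mono G₁ _ (Alive? damage₁ ∩? (both? ∘ mapT f)) λ t _ (al , al′) → al , al′ , all₁′ t) (ℕ.≤-reflexive #₁≡0))
        (ℕ.≤-trans (#Tri-mono G₂ _ (Alive? damage₂) λ _ _ → proj₁)
          (ℕ.≤-reflexive (#₂-none d₂ p₂ both? (λ t tri al al′ → all₂ t tri al , all₂′ t tri al al′) #₂≡0)))))
    helper (in₂ _ _ all₁ _) (in₁ d₁ p₁ all₁′ all₂′) = upper (ℕ.≤-trans
      (ℕ.≤-reflexive (#Tri-H (Alive? d)))
      (ℕ.+-mono-≤
        (ℕ.≤-trans (#Tri-mono G₁ _ (Alive? damage₁) λ _ _ → proj₁)
          (ℕ.≤-reflexive (#₁-none d₁ p₁ both? (λ t al′ → all₁ t , all₁′ t al′) #₁≡0)))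
        (ℕ.≤-trans (#Tri-mono G₂ _ (Alive? damage₂ ∩? (both? ∘ liftT))
            λ t tri (al , al′) → al , al′ , all₂′ t tri al)
          (ℕ.≤-reflexive #₂≡0))))
    helper (shared _ _ _ av) (in₁ _ _ _ all′) = shared-absurd₂ λ t tri al a → av t a , all′ t tri al
    helper (in₁ _ _ _ all) (shared _ _ _ av′) = shared-absurd₂ λ t tri al a → all t tri al , av′ t a
    helper (shared u end av _) (in₂ _ _ all′ _) = shared-absurd₁ u end λ t a → av t a , all′ t
    helper (in₂ _ _ all _) (shared u end av′ _) = shared-absurd₁ u end λ t a → all t , av′ t a
    helper (shared _ _ _ av) (shared _ _ _ av′) = shared-absurd₂ λ t _ _ a → av t a , av′ t a

  bounds-step : TriangleBounds H
  bounds-step = record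
    { total         = step-total
    ; avoiding      = λ v → ℕ.≤-trans (ℕ.m≤m+n 6 6) (step-avoiding v)
    ; avoiding′     = inj₂ step-avoiding
    ; damaged       = step-damaged
    ; damaged-tight = step-damaged-tight
    ; damaged-twice = step-damaged-twice
    }

OreComp⇒Gluing : ∀ {G₁ G₂ H} → OreComp G₁ G₂ H → Gluing G₁ G₂ H
OreComp⇒Gluing {G₁} O = record { OreComp O ; x≢y = Adj-irrefl G₁ (OreComp.xy-edge O) }

FourOre⇒bounds : ∀ {G} → FourOre G → TriangleBounds G
FourOre⇒bounds (base k)       = bounds-K4 _ k
FourOre⇒bounds (step o₁ o₂ O) = bounds-step (OreComp⇒Gluing O)
  (OreComp.xy-edge O) (OreComp.deg₁ O , OreComp.deg₂ O) (FourOre⇒bounds o₁) (FourOre⇒bounds o₂)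

-- The gluing given by a separation

module Separation
  {G : Graph} {x y : V G} {A B : V G → Bool} (x≢y : x ≢ y)
  (A∩B : ∀ v → ((A v ∧ B v) ≡ true) ⇔ (v ≡ x ⊎ v ≡ y))
  (A∪B : ∀ v → (A v ∨ B v) ≡ true)
  (no-cross : ∀ v w → A v ≡ true → B w ≡ true → v ≢ x → v ≢ y → w ≢ x → w ≢ y → ¬ Adj G v w)
  (x≁y : ¬ Adj G x y)
  (no-common : ∀ w → B w ≡ true → ¬ (Adj G x w × Adj G y w))
  {G′ : Graph} (e : AddEdgeOf G A x y G′) {G″ : Graph} (i : IdentifyOf G B x y G″) where

  module e = AddEdgeOf e
  module i = IdentifyOf i

  A-end : ∀ {v} → v ≡ x ⊎ v ≡ y → A v ≡ true
  A-end = proj₁ ∘ ∧⁻ ∘ from (A∩B _)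

  B-end : ∀ {v} → v ≡ x ⊎ v ≡ y → B v ≡ true
  B-end = proj₂ ∘ ∧⁻ ∘ from (A∩B _)

  Ax : A x ≡ true
  Ax = A-end (inj₁ refl)
  Ay : A y ≡ true
  Ay = A-end (inj₂ refl)
  Bx : B x ≡ true
  Bx = B-end (inj₁ refl)
  By : B y ≡ true
  By = B-end (inj₂ refl)

  -- A gluing embeds the parts into `G`, against the direction of `e.f` and `i.g`; `f` and `g` are
  -- the sections chosen by surjectivity.
  f : V G′ → V G
  f p = proj₁ (e.f-surj p)

  A-f : ∀ p → A (f p) ≡ true
  A-f p = proj₁ (proj₂ (e.f-surj p))

  ef : ∀ p → e.f (f p) ≡ p
  ef p = proj₂ (proj₂ (e.f-surj p))

  fe : ∀ {v} → A v ≡ true → f (e.f v) ≡ v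
  fe Av = e.f-inj _ _ (A-f _) Av (ef _)

  g : V G″ → V G
  g a = proj₁ (i.g-surj a)

  B-g : ∀ a → B (g a) ≡ true
  B-g a = proj₁ (proj₂ (i.g-surj a))

  ig : ∀ a → i.g (g a) ≡ a
  ig a = proj₂ (proj₂ (i.g-surj a))

  z : V G″
  z = i.g x

  iy≡z : i.g y ≡ z
  iy≡z = from (i.g-eq y x By Bx) (inj₂ (inj₂ (refl , refl)))

  g-not-end : ∀ {a} → a ≢ z → ¬ (g a ≡ x ⊎ g a ≡ y)
  g-not-end {a} a≢z (inj₁ p) = a≢z (≡.trans (≡.sym (ig a)) (cong i.g p))
  g-not-end {a} a≢z (inj₂ p) = a≢z (≡.trans (≡.sym (ig a)) (≡.trans (cong i.g p) iy≡z))

  i-fibre-z : ∀ {v} → B v ≡ true → i.g v ≡ z → v ≡ x ⊎ v ≡ y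
  i-fibre-z Bv eq with to (i.g-eq _ x Bv Bx) eq
  ... | inj₁ v≡x            = inj₁ v≡x
  ... | inj₂ (inj₁ (v≡x , _)) = inj₁ v≡x
  ... | inj₂ (inj₂ (v≡y , _)) = inj₂ v≡y

  i-fibre : ∀ {v a} → a ≢ z → B v ≡ true → i.g v ≡ a → v ≡ g a
  i-fibre {v} {a} a≢z Bv eq with to (i.g-eq v (g a) Bv (B-g a)) (≡.trans eq (≡.sym (ig a)))
  ... | inj₁ v≡ga            = v≡ga
  ... | inj₂ (inj₁ (_ , ga≡y)) = ⊥-elim (g-not-end a≢z (inj₂ ga≡y))
  ... | inj₂ (inj₂ (_ , ga≡x)) = ⊥-elim (g-not-end a≢z (inj₁ ga≡x))

  f-inj : ∀ u v → f u ≡ f v → u ≡ v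
  f-inj u v eq = ≡.trans (≡.sym (ef u)) (≡.trans (cong e.f eq) (ef v))

  f-end : ∀ {u} → B (f u) ≡ true → f u ≡ x ⊎ f u ≡ y
  f-end {u} Bfu = to (A∩B (f u)) (∧⁺ (A-f u) Bfu)

  fg-disj : ∀ u a → a ≢ z → f u ≢ g a
  fg-disj u a a≢z eq =
    g-not-end a≢z (subst (λ v → v ≡ x ⊎ v ≡ y) eq (f-end (≡.trans (cong B eq) (B-g a))))

  cover : ∀ p → (∃ λ u → f u ≡ p) ⊎ (∃ λ a → (a ≢ z) × (g a ≡ p))
  -- Vertices of `A`, with `x` and `y` among them, go to the part `G′`; the others lie in `B`
  -- outside the fibre of `z`.
  cover p with A p in Ap
  ... | true  = inj₁ (e.f p , fe Ap)
  ... | false = inj₂ (i.g p , ip≢z , ≡.sym (i-fibre ip≢z Bp refl))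
    where
    Bp : B p ≡ true
    Bp = subst (λ b → b ∨ B p ≡ true) Ap (A∪B p)
    ip≢z : i.g p ≢ z
    ip≢z eq with () ← ≡.trans (≡.sym Ap) (A-end (i-fibre-z Bp eq))

  adj-ff : ∀ u v → Adj G (f u) (f v) ⇔ (Adj G′ u v × ¬ PairEq u v (e.f x) (e.f y))
  adj-ff u v = mk⇔
    (λ uv → ≡.subst₂ (Adj G′) (ef u) (ef v) (from f-adj (inj₁ uv)) , not-ends uv)
    (λ (uv , not-xy) → fromInj₁
      (λ eq → ⊥-elim (not-xy (≡.subst₂ (λ a b → PairEq a b (e.f x) (e.f y)) (ef u) (ef v) (PairEq-map {h = e.f} eq))))
      (to f-adj (≡.subst₂ (Adj G′) (≡.sym (ef u)) (≡.sym (ef v)) uv)))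
    where
    f-adj = e.f-adj (f u) (f v) (A-f u) (A-f v)
    not-ends : Adj G (f u) (f v) → ¬ PairEq u v (e.f x) (e.f y)
    not-ends uv (inj₁ (refl , refl)) = x≁y (≡.subst₂ (Adj G) (fe Ax) (fe Ay) uv)
    not-ends uv (inj₂ (refl , refl)) = x≁y (Adj-sym G (≡.subst₂ (Adj G) (fe Ay) (fe Ax) uv))

  adj-gg : ∀ a b → a ≢ z → b ≢ z → adj G (g a) (g b) ≡ adj G″ a b
  adj-gg a b a≢z b≢z = Bool.⇔→≡ (mk⇔
    (λ ab → from (i.g-adj a b) (g a , g b , B-g a , B-g b , ig a , ig b , ab))
    (λ ab → let v , w , Bv , Bw , iv , iw , vw = to (i.g-adj a b) ab
            in ≡.subst₂ (Adj G) (i-fibre a≢z Bv iv) (i-fibre b≢z Bw iw) vw))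

  -- As `x` and `y` have no common neighbour in `B`, the neighbours of `z` on the `false` side are
  -- exactly those of `y`.
  side : V G″ → Bool
  side a = adj G x (g a)

  adj-fg : ∀ u a → a ≢ z → (Adj G (f u) (g a) ⇔
    (Adj G″ z a × ((u ≡ e.f x × side a ≡ true) ⊎ (u ≡ e.f y × side a ≡ false))))
  adj-fg u a a≢z = mk⇔ fwd bwd
    where
    fwd : Adj G (f u) (g a) → Adj G″ z a × ((u ≡ e.f x × side a ≡ true) ⊎ (u ≡ e.f y × side a ≡ false))
    fwd ua with f u ≟ x | f u ≟ y
    ... | yes fu≡x | _ =
      from (i.g-adj z a) (x , g a , Bx , B-g a , refl , ig a , xa) ,
      inj₁ (≡.trans (≡.sym (ef u)) (cong e.f fu≡x) , xa)
      where xa = subst (λ v → Adj G v (g a)) fu≡x ua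
    ... | no _ | yes fu≡y =
      from (i.g-adj z a) (y , g a , By , B-g a , iy≡z , ig a , ya) ,
      inj₂ (≡.trans (≡.sym (ef u)) (cong e.f fu≡y) , Bool.¬-not (λ xa → no-common (g a) (B-g a) (xa , ya)))
      where ya = subst (λ v → Adj G v (g a)) fu≡y ua
    ... | no fu≢x | no fu≢y = ⊥-elim (no-cross (f u) (g a) (A-f u) (B-g a) fu≢x fu≢y
      (g-not-end a≢z ∘ inj₁) (g-not-end a≢z ∘ inj₂) ua)
    bwd : Adj G″ z a × ((u ≡ e.f x × side a ≡ true) ⊎ (u ≡ e.f y × side a ≡ false)) → Adj G (f u) (g a)
    bwd (_ , inj₁ (refl , xa)) = subst (λ v → Adj G v (g a)) (≡.sym (fe Ax)) xa
    -- The edge from `z` to `a` comes from an edge of `G` at `x` or at `y`, and the `false` side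
    -- excludes `x`.
    bwd (za , inj₂ (refl , ¬xa)) with to (i.g-adj z a) za
    ... | v , w , Bv , Bw , iv , iw , vw with i-fibre-z Bv iv | i-fibre a≢z Bw iw
    ...   | inj₁ refl | refl with () ← ≡.trans (≡.sym ¬xa) vw
    ...   | inj₂ refl | refl = subst (λ v → Adj G v (g a)) (≡.sym (fe Ay)) vw

  gluing : Gluing G′ G″ G
  gluing = record
    { x = e.f x ; y = e.f y ; z = z ; side = side
    ; x≢y = x≢y ∘ e.f-inj x y Ax Ay
    ; f = f ; g = g
    ; f-inj = f-inj
    ; g-inj = λ a b _ _ eq → ≡.trans (≡.sym (ig a)) (≡.trans (cong i.g eq) (ig b))
    ; fg-disj = fg-disj
    ; cover = cover
    ; adj-ff = adj-ff
    ; adj-gg = adj-gg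
    ; adj-fg = adj-fg
    }

  xy-edge : Adj G′ (e.f x) (e.f y)
  xy-edge = from (e.f-adj x y Ax Ay) (inj₂ (inj₁ (refl , refl)))

  open Gluing gluing using (damage₁; damage₂; lift; split-end; mapT-Tri)

  -- A triangle from `G′` inside `B` would have two adjacent vertices among the nonadjacent `x` and
  -- `y`. Every vertex of a lifted triangle lies in `B`.
  #Tri-Within-B : #Tri G (Within? G B) ≡ #Tri G″ (Alive? damage₂)
  #Tri-Within-B = ≡.trans (Gluing.#Tri-H gluing (Within? G B)) (cong₂ _+_
    (count-empty (triples (n G′)) _ λ t (tri , al , Bi , Bj , _) →
      not-both (proj₁ (mapT-Tri t tri al)) (f-end Bi) (f-end Bj))
    (#Tri-cong G″ _ _ (λ _ _ → proj₁) λ (a , b , c) _ al → al , B-lift a b , B-lift b c , B-lift c a))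
    where
    not-both : ∀ {v w} → Adj G v w → v ≡ x ⊎ v ≡ y → w ≡ x ⊎ w ≡ y → ⊥
    not-both vw (inj₁ refl) (inj₁ refl) = Adj-irrefl G vw refl
    not-both vw (inj₁ refl) (inj₂ refl) = x≁y vw
    not-both vw (inj₂ refl) (inj₁ refl) = x≁y (Adj-sym G vw)
    not-both vw (inj₂ refl) (inj₂ refl) = Adj-irrefl G vw refl
    B-split-end : ∀ b → B (f (split-end b)) ≡ true
    B-split-end true  = ≡.trans (cong B (fe Ax)) Bx
    B-split-end false = ≡.trans (cong B (fe Ay)) By
    B-lift : ∀ a b → B (lift a b) ≡ true
    B-lift a b with a ≟ z
    ... | yes _ = B-split-end (side b)
    ... | no _  = B-g a

-- Tightness of the bounds for a separation

-- If one half is empty, `s` is constant on the neighbours of `z`, so no corner at `z` is torn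
-- apart.
improper-split : (G : Graph) → ∀ z s → ¬ Proper G (split z s) → ∀ t → Tri G t → Alive (split z s) t
improper-split G z s improper t tri =
  corner t tri , corner _ (Tri-rotate G t tri) , corner _ (Tri-rotate G _ (Tri-rotate G t tri))
  where
  corner : ∀ t → Tri G t → Corner (split z s) t
  corner (_ , a , b) (za , _ , bz) refl with s a in sa | s b in sb
  ... | true  | true  = refl
  ... | false | false = refl
  ... | true  | false = ⊥-elim (improper ((a , za , sa) , (b , Adj-sym G bz , sb)))
  ... | false | true  = ⊥-elim (improper ((b , Adj-sym G bz , sb) , (a , za , sa)))

theorem11 : (G : Graph) → FourOre G → ¬ IsK4 G → triCount G ≡ 4 →
    (x y : V G) → (A B : V G → Bool) →
    x ≢ y →
    (∀ v → ((A v ∧ B v) ≡ true) ⇔ (v ≡ x ⊎ v ≡ y)) →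
    (∀ v → (A v ∨ B v) ≡ true) →
    (∀ v w → A v ≡ true → B w ≡ true → v ≢ x → v ≢ y → w ≢ x → w ≢ y → ¬ Adj G v w) →
    ¬ Adj G x y →
    (∀ w → B w ≡ true → ¬ (Adj G x w × Adj G y w)) →
    (G′ : Graph) → (e : AddEdgeOf G A x y G′) → FourOre G′ →
    (G″ : Graph) → (i : IdentifyOf G B x y G″) → FourOre G″ →
    (FourOre G′ × triCount G′ ≡ 4) ×
    (FourOre G″ × triCount G″ ≡ 4) ×
    DiamondEdge G′ (AddEdgeOf.f e x) (AddEdgeOf.f e y) ×
    triCountIn G B ≡ 2 ×
    (¬ IsK4 G″ → triAt G″ (IdentifyOf.g i x) ≡ 2)
theorem11 G _ _ four x y A B x≢y A∩B A∪B no-cross x≁y no-common G′ e ore′ G″ i ore″ =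
  (ore′ , sixth (≡.trans (≡.sym (#Tri-triCount G′)) total′≡24)) ,
  (ore″ , sixth (≡.trans (≡.sym (#Tri-triCount G″)) total″≡24)) ,
  (xy-edge , twelve+ alive′≡12 (≡.trans (≡.sym (#Tri-triAtPair G′ xy-edge)) total′≡24)) ,
  sixth (≡.trans (≡.sym (#Tri-triCountIn G B)) (≡.trans #Tri-Within-B alive″≡12)) ,
  λ ¬k4 → twelve+ (avoid≡12 ¬k4) (≡.trans (≡.sym (#Tri-triAt G″ z)) total″≡24)
  where
  open Separation x≢y A∩B A∪B no-cross x≁y no-common e i
  open Gluing gluing using (damage₁; damage₂)
  module B′ = TriangleBounds (FourOre⇒bounds ore′)
  module B″ = TriangleBounds (FourOre⇒bounds ore″)

  sixth : ∀ {a b} → 6 * a ≡ 6 * b → a ≡ b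
  sixth = ℕ.*-cancelˡ-≡ _ _ 6

  -- In units of six: of four triangles two survive the deletion or avoid the vertex, which leaves
  -- two on the edge or at the vertex.
  twelve+ : ∀ {a b} → a ≡ 12 → a + 6 * b ≡ 24 → b ≡ 2
  twelve+ {b = b} refl eq = sixth (ℕ.+-cancelˡ-≡ 12 (6 * b) 12 eq)

  alive-sum : #Tri G′ (Alive? damage₁) + #Tri G″ (Alive? damage₂) ≡ 24
  alive-sum = ≡.trans (≡.sym (≡.trans (Gluing.#Tri-H gluing All?) (cong₂ _+_ (#₁-All gluing) (#₂-All gluing))))
    (≡.trans (#Tri-triCount G) (cong (6 *_) four))

  ≥12 : 12 ≤ #Tri G′ (Alive? damage₁)
  ≥12 = B′.damaged damage₁ xy-edge

  proper : Proper G″ damage₂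
  proper with Proper? G″ damage₂
  ... | yes p = p
  -- Were one half empty, all of the at least 24 ordered triangles of `G″` would survive; with 12
  -- from `G′` this gives 36, more than 24.
  ... | no ¬p = ⊥-elim (ℕ.<⇒≱ (ℕ.m<m+n 24 {12} (s≤s z≤n)) (ℕ.≤-trans
    (ℕ.+-mono-≤ ≥12 (ℕ.≤-trans B″.total (#Tri-mono G″ All? (Alive? damage₂)
      λ t tri _ → improper-split G″ z side ¬p t tri)))
    (ℕ.≤-reflexive alive-sum)))

  alive′≡12 : #Tri G′ (Alive? damage₁) ≡ 12
  alive′≡12 = ≤-sum-tightˡ ≥12 (B″.damaged damage₂ proper) alive-sum

  alive″≡12 : #Tri G″ (Alive? damage₂) ≡ 12
  alive″≡12 = ≤-sum-tightʳ ≥12 (B″.damaged damage₂ proper) alive-sum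

  total′≡24 : #Tri G′ All? ≡ 24
  total′≡24 = B′.damaged-tight damage₁ xy-edge alive′≡12

  total″≡24 : #Tri G″ All? ≡ 24
  total″≡24 = B″.damaged-tight damage₂ proper alive″≡12

  avoid≡12 : ¬ IsK4 G″ → #Tri G″ (Avoids? z) ≡ 12
  avoid≡12 ¬k4 with B″.avoiding′
  ... | inj₁ k4  = ⊥-elim (¬k4 k4)
  -- Triangles avoiding `z` survive its split, so there are at most 12; outside `K₄` there are at
  -- least 12.
  ... | inj₂ ≥12 = ℕ.≤-antisym
    (ℕ.≤-trans (#Tri-mono G″ (Avoids? z) (Alive? damage₂)
      λ t _ (a , b , c) → ⊥-elim ∘ a , ⊥-elim ∘ b , ⊥-elim ∘ c) (ℕ.≤-reflexive alive″≡12))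
    (≥12 z)
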